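{- Let $\mathsf T,\mathsf E$ be real $2m\times2m$ matrices and let $J,\mathsf N$ be real $2m\times m$ matrices, with the $2m$ coordinates grouped into $m$ consecutive pairs. Suppose $I-\mathsf T$ is invertible, $J^*J=I$, and $\mathsf E\succeq\mathsf T^*\mathsf C\mathsf T$, where $\mathsf C=\bigoplus_{i=1}^m C_iI_2$ and $C_i>0$. Assume the $i$-th columns $j_i,n_i$ of $J,\mathsf N$ are supported on the $i$-th coordinate pair (and regard them as vectors in $\mathbb R^2$); let $\mathsf E_{ii},\mathsf T_{ii}$ denote the $i$-th diagonal $2\times2$ blocks. Choose real symmetric $2\times2$ matrices $W_i\succ0$, real $2\times2$ matrices $D_i$, and numbers $K_i>0$, $h_i\ge0$, and define $$B_i=D_i^*W_i^{ -1},\quad U_i=W_i^{ -1}D_iW_i,\quad R_i=\frac{B_i^*B_i}{4C_i},\quad d_i^*=j_i^*B_i+n_i^*W_i .$$ Suppose that for every $i$, $$\operatorname{tr}(\mathsf E_{ii}W_i^2)+\operatorname{tr}(D_i\mathsf T_{ii})\le h_i,\qquad \chi_i:=h_i+\operatorname{tr}R_i>0,\qquad \operatorname{Sym}U_i-h_iI_2-\operatorname{adj}R_i-\frac{d_id_i^*}{4K_i}\succeq0 .$$ Then there is a nonzero covariance of exact responses, i.e. a centered random pair $(\xi,y)\in\mathbb R^m\times\mathbb R^{2m}$ with finite second moments, not almost surely zero, satisfying $(I-\mathsf T)y=J\xi$ almost surely, for which $$\mathbb E\bigl(y^*\mathsf Ey+\xi^*\mathsf N^*y\bigr)\le\sum_{i=1}^mK_i\,\mathbb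 E\,\xi_i^2 .$$
   Context: $^*$ denotes transpose. For a real $2\times2$ matrix, $\operatorname{Sym}U=(U+U^*)/2$ and, for symmetric $R$, $\operatorname{adj}R=(\operatorname{tr}R)I_2-R$. $A\succeq B$ means $A-B$ is symmetric positive semidefinite. An "exact response" is a pair $(\xi,y)$ with $(I-\mathsf T)y=J\xi$. -}

module Defs where

open import Level using (0ℓ; suc)
open import Algebra.Bundles using (CommutativeRing)
open import Data.Bool.Base using (if_then_else_)
open import Data.Fin.Base using (Fin; toℕ; combine; remQuot)
open import Data.Fin.Properties using (_≟_)
open import Data.Nat.Base as ℕ using (ℕ)
open import Data.Product.Base using (Σ-syntax; ∃-syntax; _×_; _,_; proj₁; proj₂)
open import Data.Vec.Functional using (Vector)
open import Relation.Binary.Bundles using (TotalOrder)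
open import Relation.Binary.Core using (Rel)
open import Relation.Binary.PropositionalEquality.Core using (_≢_)
open import Relation.Binary.Structures using (IsTotalOrder)
open import Relation.Nullary.Decidable.Core using (does)
open import Relation.Unary using (Pred; U; ∁; ⋃; _∈_; _⊆_; _≐_; _⊥_)
import Algebra.Construct.NaturalChoice.Max as Max
import Algebra.Properties.Semiring.Sum as Sum
import Relation.Binary.Construct.NonStrictToStrict as Strict

module _ {A : Set} (_≤_ : Rel A 0ℓ) where

  UpperBound : ∀ {ℓ} → Pred A ℓ → A → Set ℓ
  UpperBound S u = ∀ s → s ∈ S → s ≤ u

  IsLub : ∀ {ℓ} → Pred A ℓ → A → Set ℓ
  IsLub S v = UpperBound S v × (∀ u → UpperBound S u → v ≤ u)

-- The real numbers, given axiomatically as a Dedekind-complete ordered field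
-- (classically unique up to isomorphism).  As usual for a total inverse, the
-- value of 0# ⁻¹ is unspecified.
record Reals : Set (suc 0ℓ) where
  field
    commutativeRing : CommutativeRing 0ℓ 0ℓ
  open CommutativeRing commutativeRing public
  infix 4 _≤_
  infix 9 _⁻¹
  field
    _≤_          : Rel Carrier 0ℓ
    isTotalOrder : IsTotalOrder _≈_ _≤_
    +-monoʳ-≤    : ∀ x {y z} → y ≤ z → x + y ≤ x + z
    *-nonNeg     : ∀ {x y} → 0# ≤ x → 0# ≤ y → 0# ≤ x * y
    1≉0          : 1# ≉ 0#
    _⁻¹          : Carrier → Carrier
    *-inverseʳ   : ∀ {x} → x ≉ 0# → x * x ⁻¹ ≈ 1#
    complete     : (S : Pred Carrier 0ℓ) → ∃[ s ] s ∈ S →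
                   ∃[ u ] UpperBound _≤_ S u → ∃[ v ] IsLub _≤_ S v

  totalOrder : TotalOrder 0ℓ 0ℓ 0ℓ
  totalOrder = record { isTotalOrder = isTotalOrder }

  open Strict _≈_ _≤_ public using (_<_)
  open Max totalOrder public using (_⊔_)
  open Sum semiring public using (sum; sum-syntax)

  2# 4# : Carrier
  2# = 1# + 1#
  4# = 2# + 2#

module LinearAlgebra (ℝ : Reals) where
  open Reals ℝ

  Matrix : ℕ → ℕ → Set
  Matrix r c = Fin r → Fin c → Carrier

  infix  10 _ᵀ
  infixl 8 _·_
  infixr 8 _∙_
  infixr 8 _*ᵥ_
  infixl 6 _⊕_ _⊖_
  infix  4 _≋_ _⪰_

  _≋_ : ∀ {r c} → Rel (Matrix r c) 0ℓ
  A ≋ B = ∀ i j → A i j ≈ B i j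

  _ᵀ : ∀ {r c} → Matrix r c → Matrix c r
  (A ᵀ) i j = A j i

  _·_ : ∀ {r n c} → Matrix r n → Matrix n c → Matrix r c
  _·_ {n = n} A B i j = ∑[ k < n ] (A i k * B k j)

  _⊕_ _⊖_ : ∀ {r c} → Matrix r c → Matrix r c → Matrix r c
  (A ⊕ B) i j = A i j + B i j
  (A ⊖ B) i j = A i j - B i j

  _∙_ : ∀ {r c} → Carrier → Matrix r c → Matrix r c
  (x ∙ A) i j = x * A i j

  I : ∀ {n} → Matrix n n
  I i j = if does (i ≟ j) then 1# else 0#

  tr : ∀ {n} → Matrix n n → Carrier
  tr {n} A = ∑[ i < n ] A i i

  ⟨_,_⟩ : ∀ {n} → Vector Carrier n → Vector Carrier n → Carrier
  ⟨_,_⟩ {n} x y = ∑[ i < n ] (x i * y i)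

  _*ᵥ_ : ∀ {r c} → Matrix r c → Vector Carrier c → Vector Carrier r
  (A *ᵥ x) i = ⟨ A i , x ⟩

  -- The rank-one matrix x y*.
  outer : ∀ {r c} → Vector Carrier r → Vector Carrier c → Matrix r c
  outer x y i j = x i * y j

  IsInverse : ∀ {n} → Matrix n n → Matrix n n → Set
  IsInverse A B = (A · B ≋ I) × (B · A ≋ I)

  Invertible : ∀ {n} → Matrix n n → Set
  Invertible A = ∃[ B ] IsInverse A B

  Symmetric : ∀ {n} → Matrix n n → Set
  Symmetric A = A ᵀ ≋ A

  PosSemidef : ∀ {n} → Matrix n n → Set
  PosSemidef A = Symmetric A × (∀ x → 0# ≤ ⟨ x , A *ᵥ x ⟩)

  PosDef : ∀ {n} → Matrix n n → Set
  PosDef A = Symmetric A ×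
    (∀ x → ∃[ i ] x i ≉ 0# → 0# < ⟨ x , A *ᵥ x ⟩)

  _⪰_ : ∀ {n} → Rel (Matrix n n) 0ℓ
  A ⪰ B = PosSemidef (A ⊖ B)

  Sym : Matrix 2 2 → Matrix 2 2
  Sym A = 2# ⁻¹ ∙ (A ⊕ A ᵀ)

  adj : Matrix 2 2 → Matrix 2 2
  adj R = (tr R ∙ I) ⊖ R

  -- The 2m coordinates are indexed by Fin (m * 2); combine i a is 2i + a, so
  -- the i-th consecutive pair consists of combine i 0 and combine i 1.

  block : ∀ {m} → Matrix (m ℕ.* 2) (m ℕ.* 2) → Fin m → Matrix 2 2
  block A i a b = A (combine i a) (combine i b)

  directSum : ∀ {m} → (Fin m → Matrix 2 2) → Matrix (m ℕ.* 2) (m ℕ.* 2)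
  directSum A p q =
    let (i , a) = remQuot 2 p
        (k , b) = remQuot 2 q
    in  if does (i ≟ k) then A i a b else 0#

  PairSupported : ∀ {m} → Matrix (m ℕ.* 2) m → Set
  PairSupported {m} J = ∀ (i k : Fin m) a → k ≢ i → J (combine k a) i ≈ 0#

  column : ∀ {m} → Matrix (m ℕ.* 2) m → Fin m → Vector Carrier 2
  column J i a = J (combine i a) i

module Probability (ℝ : Reals) where
  open Reals ℝ

  -- P is only meaningful on events.  A series of nonnegative terms is summed
  -- by taking the supremum of its partial sums.
  record ProbabilitySpace : Set (suc 0ℓ) where
    field
      Ω         : Set
      Event     : Pred Ω 0ℓ → Set
      Event-U   : Event U
      Event-∁   : ∀ {A} → Event A → Event (∁ A)
      Event-⋃   : ∀ (A : ℕ → Pred Ω 0ℓ) → (∀ n → Event (A n)) → Event (⋃ ℕ A)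
      Event-≐   : ∀ {A B} → A ≐ B → Event A → Event B
      P         : Pred Ω 0ℓ → Carrier
      P-≐       : ∀ {A B} → A ≐ B → Event A → P A ≈ P B
      P-nonNeg  : ∀ {A} → Event A → 0# ≤ P A
      P-U       : P U ≈ 1#
      P-⋃       : ∀ (A : ℕ → Pred Ω 0ℓ) → (∀ n → Event (A n)) →
                  (∀ k l → k ≢ l → A k ⊥ A l) →
                  IsLub _≤_ (λ s → ∃[ n ] s ≈ ∑[ k < n ] P (A (toℕ k)))
                        (P (⋃ ℕ A))

  module _ (𝓟 : ProbabilitySpace) where
    open ProbabilitySpace 𝓟

    AlmostSurely : Pred Ω 0ℓ → Set (suc 0ℓ)
    AlmostSurely Q = ∃[ A ] Event A × A ⊆ Q × P A ≈ 1#

    Measurable : (Ω → Carrier) → Set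
    Measurable f = ∀ c → Event (λ ω → f ω ≤ c)

    -- s is the integral of a nonnegative simple function lying below f.
    LowerSum : (Ω → Carrier) → Pred Carrier (suc 0ℓ)
    LowerSum f s =
      ∃[ n ] Σ[ A ∈ (Fin n → Pred Ω 0ℓ) ] Σ[ c ∈ Vector Carrier n ]
        (∀ k → Event (A k)) ×
        (∀ k l → k ≢ l → A k ⊥ A l) ×
        (∀ k → 0# ≤ c k) ×
        (∀ k ω → ω ∈ A k → c k ≤ f ω) ×
        s ≈ ∑[ k < n ] (c k * P (A k))

    -- f is Lebesgue integrable with expectation v, where v = 𝔼 f⁺ − 𝔼 f⁻ and
    -- both parts have a finite integral.
    Expectation : (Ω → Carrier) → Carrier → Set (suc 0ℓ)
    Expectation f v = Measurable f ×
      ∃[ v⁺ ] ∃[ v⁻ ] IsLub _≤_ (LowerSum (λ ω → f ω ⊔ 0#)) v⁺ ×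
                      IsLub _≤_ (LowerSum (λ ω → (- f ω) ⊔ 0#)) v⁻ ×
                      v ≈ v⁺ - v⁻

    Centered : ∀ {n} → (Ω → Vector Carrier n) → Set (suc 0ℓ)
    Centered X = ∀ i → Expectation (λ ω → X ω i) 0#

    FiniteSecondMoments : ∀ {n} → (Ω → Vector Carrier n) → Set (suc 0ℓ)
    FiniteSecondMoments X = ∀ i → ∃[ v ] Expectation (λ ω → X ω i * X ω i) v

{-# OPTIONS --safe #-}

-- For an exact response (ξ , y) put v = W⁻¹ y.  Completing the square in ξᵢ,
-- the condition on Sym Uᵢ gives, since h + adj R = χ I − R,
--   y*Ey + ξ*N*y − Σ Kᵢ ξᵢ² ≤ Φ(v) − Σ χᵢ |vᵢ|²,
-- where Φ(v) = (Wv)*E(Wv) + ⟨Bv , TWv⟩ + v*Rv.  As E ⪰ T*CT, the form Φ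
-- dominates a sum of squares, and tr Φᵢᵢ ≤ χᵢ.  So in the inner product
-- Σ χᵢ ⟨uᵢ , vᵢ⟩ the positive form Φ has trace at most m, and on the
-- m-dimensional space of all v it cannot exceed the norm everywhere.  A
-- response where it does not, with a random sign, is the required covariance.

module Submission where

open import Defs
open import Level using (0ℓ)
open import Algebra.Bundles using (CommutativeRing)
open import Algebra.Solver.Ring.AlmostCommutativeRing
  using (fromCommutativeRing; _-Raw-AlmostCommutative⟶_)
open import Axiom.ExcludedMiddle using (ExcludedMiddle)
open import Data.Bool.Base using (Bool; true; false; if_then_else_)
open import Data.Fin.Base using (Fin; zero; suc; toℕ; fromℕ<; combine; quotient; remQuot)
open import Data.Fin.Properties
  using (_≟_; suc-injective; toℕ-injective; toℕ-fromℕ<; combine-remQuot; remQuot-combine)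
open import Data.Integer.Base as ℤ using (ℤ; +_; -[1+_]; _◃_)
open import Data.Maybe.Base using (Maybe; just; nothing)
open import Data.Nat.Base as ℕ using (ℕ; zero; suc; NonZero)
open import Data.Product.Base using (Σ-syntax; ∃-syntax; _×_; _,_; proj₁; proj₂)
open import Data.Sum.Base using (inj₁; inj₂; [_,_]′)
open import Data.Unit.Base using (⊤; tt)
open import Data.Vec.Functional using (Vector; _∷_)
open import Function.Base using (_∘_)
open import Relation.Binary.Bundles using (TotalOrder)
open import Relation.Nullary using (yes; no; contradiction)
open import Relation.Nullary.Decidable using (dec-true)
open import Relation.Nullary.Decidable.Core using (does)
open import Relation.Nullary.Negation.Core using (¬_)
open import Relation.Unary using (Pred; _∈_; _∉_; _≐_; _⊥_; ⋃) renaming (U to Univ)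
import Algebra.Construct.NaturalChoice.Max as Max
import Algebra.Properties.Ring as RingProperties
import Algebra.Properties.Semiring.Mult.TCOptimised as Mult
import Algebra.Properties.Semiring.Sum as SemiringSum
import Algebra.Solver.Ring as RingSolver
import Data.Integer.Properties as ℤ
import Data.Nat.Properties as ℕ
import Data.Sign.Base as Sign
import Relation.Binary.PropositionalEquality.Core as ≡
open ≡ using (_≡_; _≢_)

-- The multiplier Bv is what makes exactness usable. From y = Ty + Jξ follows ⟨Bv, y⟩ = ⟨Bv, Ty⟩ +
-- ⟨Bv, Jξ⟩. The left side is the total of the forms of Sym Uᵢ at vᵢ, because Uᵢ = Bᵢ*Wᵢ. The first
-- term on the right is a part of Φ. The second is linear in ξ and joins ξ*N*y to give Σ ξᵢ ⟨dᵢ ,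
-- vᵢ⟩, which is where dᵢ comes from. The matrix Rᵢ = Bᵢ*Bᵢ/4Cᵢ is the least constant term that
-- completes Cᵢ|t|² + ⟨Bᵢvᵢ , t⟩ to a square in t. The obstacle is that Φ need not be symmetric,
-- since B*TW need not be, and that the space of all v comes with a basis that is not orthonormal.
-- Eigenvalues and square roots are avoided: Gram-Schmidt is interleaved with compressions of the
-- form. Positivity carries the dimension count, since the trace over all 2m coordinates bounds the
-- trace over an m-dimensional subspace only if the discarded directions contribute nonnegatively. A
-- trace of at most m over m orthonormal directions then leaves some direction with value at most 1.

-- A ring solver with integer coefficients.

module IntegerCoefficientSolver (R : CommutativeRing 0ℓ 0ℓ) where
  open CommutativeRing R
  open RingProperties ring
  open Mult semiring renaming (_×_ to _⋆_)
  open import Relation.Binary.Reasoning.Setoid setoid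

  -- The canonical ring map from the integers. Equality in an abstract ring cannot be decided,
  -- whereas the solver has to compare coefficients; integers allow that and still cover every
  -- constant that occurs.
  ⟦_⟧ℤ : ℤ → Carrier
  ⟦ + n ⟧ℤ      = n ⋆ 1#
  ⟦ -[1+ n ] ⟧ℤ = - (suc n ⋆ 1#)

  ⟦⟧-neg : ∀ n → ⟦ ℤ.- (+ n) ⟧ℤ ≈ - (n ⋆ 1#)
  ⟦⟧-neg zero    = sym -0#≈0#
  ⟦⟧-neg (suc n) = refl

  ⟦⟧-⊖ : ∀ m n → ⟦ m ℤ.⊖ n ⟧ℤ ≈ m ⋆ 1# - n ⋆ 1#
  ⟦⟧-⊖ zero zero = sym (trans (+-congˡ -0#≈0#) (+-identityʳ _))
  ⟦⟧-⊖ zero (suc n) = sym (+-identityˡ _)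
  ⟦⟧-⊖ (suc m) zero = sym (trans (+-congˡ -0#≈0#) (+-identityʳ _))
  ⟦⟧-⊖ (suc m) (suc n) = begin
    ⟦ suc m ℤ.⊖ suc n ⟧ℤ                  ≡⟨ ≡.cong ⟦_⟧ℤ (ℤ.[1+m]⊖[1+n]≡m⊖n m n) ⟩
    ⟦ m ℤ.⊖ n ⟧ℤ                          ≈⟨ ⟦⟧-⊖ m n ⟩
    m ⋆ 1# - n ⋆ 1#                     ≈⟨ +-congʳ (+-identityˡ _) ⟨
    (0# + m ⋆ 1#) - n ⋆ 1#              ≈⟨ +-congʳ (+-congʳ (-‿inverseʳ 1#)) ⟨
    ((1# - 1#) + m ⋆ 1#) - n ⋆ 1#       ≈⟨ +-congʳ (+-assoc _ _ _) ⟩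
    (1# + (- 1# + m ⋆ 1#)) - n ⋆ 1#     ≈⟨ +-congʳ (+-congˡ (+-comm _ _)) ⟩
    (1# + (m ⋆ 1# - 1#)) - n ⋆ 1#       ≈⟨ +-congʳ (+-assoc _ _ _) ⟨
    ((1# + m ⋆ 1#) - 1#) - n ⋆ 1#       ≈⟨ +-assoc _ _ _ ⟩
    (1# + m ⋆ 1#) + (- 1# - n ⋆ 1#)     ≈⟨ +-congˡ (-‿+-comm _ _) ⟩
    (1# + m ⋆ 1#) - (1# + n ⋆ 1#)       ≈⟨ +-cong (1+× m 1#) (-‿cong (1+× n 1#)) ⟨
    suc m ⋆ 1# - suc n ⋆ 1#             ∎

  ⟦⟧-+ : ∀ x y → ⟦ x ℤ.+ y ⟧ℤ ≈ ⟦ x ⟧ℤ + ⟦ y ⟧ℤ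
  ⟦⟧-+ (+ m)    (+ n)    = ×-homo-+ 1# m n
  ⟦⟧-+ (+ m)    -[1+ n ] = ⟦⟧-⊖ m (suc n)
  ⟦⟧-+ -[1+ m ] (+ n)    = trans (⟦⟧-⊖ n (suc m)) (+-comm _ _)
  ⟦⟧-+ -[1+ m ] -[1+ n ] = begin
    ⟦ -[1+ m ] ℤ.+ -[1+ n ] ⟧ℤ             ≡⟨ ≡.cong ⟦_⟧ℤ (ℤ.neg-distrib-+ (+ suc m) (+ suc n)) ⟨
    - ((suc m ℕ.+ suc n) ⋆ 1#)             ≈⟨ -‿cong (×-homo-+ 1# (suc m) (suc n)) ⟩
    - (suc m ⋆ 1# + suc n ⋆ 1#)            ≈⟨ -‿+-comm _ _ ⟨
    - (suc m ⋆ 1#) - suc n ⋆ 1#            ∎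

  ⟦⟧-* : ∀ x y → ⟦ x ℤ.* y ⟧ℤ ≈ ⟦ x ⟧ℤ * ⟦ y ⟧ℤ
  ⟦⟧-* (+ m) (+ n) = begin
    ⟦ Sign.+ ◃ m ℕ.* n ⟧ℤ     ≡⟨ ≡.cong ⟦_⟧ℤ (ℤ.+◃n≡+n (m ℕ.* n)) ⟩
    (m ℕ.* n) ⋆ 1#            ≈⟨ ×1-homo-* m n ⟩
    m ⋆ 1# * n ⋆ 1#           ∎
  ⟦⟧-* (+ m) -[1+ n ] = begin
    ⟦ Sign.- ◃ m ℕ.* suc n ⟧ℤ ≡⟨ ≡.cong ⟦_⟧ℤ (ℤ.-◃n≡-n (m ℕ.* suc n)) ⟩
    ⟦ ℤ.- (+ (m ℕ.* suc n)) ⟧ℤ ≈⟨ ⟦⟧-neg (m ℕ.* suc n) ⟩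
    - ((m ℕ.* suc n) ⋆ 1#)    ≈⟨ -‿cong (×1-homo-* m (suc n)) ⟩
    - (m ⋆ 1# * suc n ⋆ 1#)   ≈⟨ -‿distribʳ-* _ _ ⟩
    m ⋆ 1# * - (suc n ⋆ 1#)   ∎
  ⟦⟧-* -[1+ m ] (+ n) = begin
    ⟦ Sign.- ◃ suc m ℕ.* n ⟧ℤ ≡⟨ ≡.cong ⟦_⟧ℤ (ℤ.-◃n≡-n (suc m ℕ.* n)) ⟩
    ⟦ ℤ.- (+ (suc m ℕ.* n)) ⟧ℤ ≈⟨ ⟦⟧-neg (suc m ℕ.* n) ⟩
    - ((suc m ℕ.* n) ⋆ 1#)    ≈⟨ -‿cong (×1-homo-* (suc m) n) ⟩
    - (suc m ⋆ 1# * n ⋆ 1#)   ≈⟨ -‿distribˡ-* _ _ ⟩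
    - (suc m ⋆ 1#) * n ⋆ 1#   ∎
  ⟦⟧-* -[1+ m ] -[1+ n ] = begin
    ⟦ Sign.+ ◃ suc m ℕ.* suc n ⟧ℤ     ≡⟨ ≡.cong ⟦_⟧ℤ (ℤ.+◃n≡+n (suc m ℕ.* suc n)) ⟩
    (suc m ℕ.* suc n) ⋆ 1#            ≈⟨ ×1-homo-* (suc m) (suc n) ⟩
    suc m ⋆ 1# * suc n ⋆ 1#           ≈⟨ -‿involutive _ ⟨
    - - (suc m ⋆ 1# * suc n ⋆ 1#)     ≈⟨ -‿cong (-‿distribʳ-* _ _) ⟩
    - (suc m ⋆ 1# * - (suc n ⋆ 1#))   ≈⟨ -‿distribˡ-* _ _ ⟩
    - (suc m ⋆ 1#) * - (suc n ⋆ 1#)   ∎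

  ⟦⟧-- : ∀ x → ⟦ ℤ.- x ⟧ℤ ≈ - ⟦ x ⟧ℤ
  ⟦⟧-- (+ n)    = ⟦⟧-neg n
  ⟦⟧-- -[1+ n ] = sym (-‿involutive _)

  morphism : ℤ.+-*-rawRing -Raw-AlmostCommutative⟶ fromCommutativeRing R
  morphism = record
    { ⟦_⟧ = ⟦_⟧ℤ ; +-homo = ⟦⟧-+ ; *-homo = ⟦⟧-* ; -‿homo = ⟦⟧--
    ; 0-homo = refl ; 1-homo = refl }

  ⟦⟧-≟ : ∀ x y → Maybe (⟦ x ⟧ℤ ≈ ⟦ y ⟧ℤ)
  ⟦⟧-≟ x y with x ℤ.≟ y
  ... | yes x≡y = just (reflexive (≡.cong ⟦_⟧ℤ x≡y))
  ... | no  _   = nothing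

  open RingSolver ℤ.+-*-rawRing (fromCommutativeRing R) morphism ⟦⟧-≟ public
    using (solve; _:=_; _:+_; _:*_; _:-_; :-_; con; Polynomial)

-- Ordered-field inequalities and finite sums.

module OrderedField (ℝ : Reals) where
  open Reals ℝ hiding (zero)
  open SemiringSum semiring public using
    (sum-cong-≋; sum-replicate-zero; ∑-distrib-+; ∑-comm; *-distribˡ-sum; *-distribʳ-sum)
  open IntegerCoefficientSolver commutativeRing public
  open TotalOrder totalOrder public
    using (antisym; total; ≤-respˡ-≈; ≤-respʳ-≈)
    renaming (refl to ≤-refl; trans to ≤-trans; reflexive to ≤-reflexive)

  -- The sums mirror the definitions of `2#` and `4#`, so that these polynomials evaluate to those
  -- constants by computation; an integer literal 4 would evaluate to a differently bracketed sum of
  -- units.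
  1ᵖ 2ᵖ 4ᵖ : ∀ {n} → Polynomial n
  1ᵖ = con (+ 1)
  2ᵖ = 1ᵖ :+ 1ᵖ
  4ᵖ = 2ᵖ :+ 2ᵖ

  +-monoˡ-≤ : ∀ x {y z} → y ≤ z → y + x ≤ z + x
  +-monoˡ-≤ x y≤z = ≤-respˡ-≈ (+-comm _ _) (≤-respʳ-≈ (+-comm _ _) (+-monoʳ-≤ x y≤z))

  +-mono-≤ : ∀ {x y u v} → x ≤ y → u ≤ v → x + u ≤ y + v
  +-mono-≤ {y = y} {u} x≤y u≤v = ≤-trans (+-monoˡ-≤ u x≤y) (+-monoʳ-≤ y u≤v)

  +-nonNeg : ∀ {x y} → 0# ≤ x → 0# ≤ y → 0# ≤ x + y
  +-nonNeg 0≤x 0≤y = ≤-respˡ-≈ (+-identityʳ 0#) (+-mono-≤ 0≤x 0≤y)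

  ≤⇒0≤- : ∀ {x y} → x ≤ y → 0# ≤ y - x
  ≤⇒0≤- {x} x≤y = ≤-respˡ-≈ (-‿inverseʳ x) (+-monoˡ-≤ (- x) x≤y)

  0≤-⇒≤ : ∀ {x y} → 0# ≤ y - x → x ≤ y
  0≤-⇒≤ {x} {y} 0≤y-x = ≤-respˡ-≈ (+-identityˡ x)
    (≤-respʳ-≈ (solve 2 (λ x y → (y :- x) :+ x := y) refl x y) (+-monoˡ-≤ x 0≤y-x))

  ≤-byDifference : ∀ {x y} z → 0# ≤ z → y - x ≈ z → x ≤ y
  ≤-byDifference z 0≤z eq = 0≤-⇒≤ (≤-respʳ-≈ (sym eq) 0≤z)

  neg-nonNeg : ∀ {x} → x ≤ 0# → 0# ≤ - x
  neg-nonNeg x≤0 = ≤-respʳ-≈ (+-identityˡ _) (≤⇒0≤- x≤0)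

  *-monoˡ-≤-nonNeg : ∀ {x y z} → 0# ≤ x → y ≤ z → x * y ≤ x * z
  *-monoˡ-≤-nonNeg {x} {y} {z} 0≤x y≤z = ≤-byDifference _ (*-nonNeg 0≤x (≤⇒0≤- y≤z))
    (solve 3 (λ x y z → x :* z :- x :* y := x :* (z :- y)) refl x y z)

  square-nonNeg : ∀ x → 0# ≤ x * x
  square-nonNeg x with total 0# x
  ... | inj₁ 0≤x = *-nonNeg 0≤x 0≤x
  ... | inj₂ x≤0 = ≤-respʳ-≈ (solve 1 (λ x → :- x :* :- x := x :* x) refl x)
                     (*-nonNeg (neg-nonNeg x≤0) (neg-nonNeg x≤0))

  0≤1 : 0# ≤ 1#
  0≤1 = ≤-respʳ-≈ (*-identityˡ 1#) (square-nonNeg 1#)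

  <⇒≉0 : ∀ {x} → 0# < x → x ≉ 0#
  <⇒≉0 (_ , 0≉x) x≈0 = 0≉x (sym x≈0)

  0<x+y : ∀ {x y} → 0# < x → 0# ≤ y → 0# < x + y
  0<x+y {x} {y} (0≤x , 0≉x) 0≤y = +-nonNeg 0≤x 0≤y , λ 0≈x+y →
    0≉x (antisym 0≤x (≤-respʳ-≈ (sym 0≈x+y) (≤-respˡ-≈ (+-identityʳ x) (+-monoʳ-≤ x 0≤y))))

  x*y≈0⇒y≈0 : ∀ {x y} → x ≉ 0# → x * y ≈ 0# → y ≈ 0#
  x*y≈0⇒y≈0 {x} {y} x≉0 xy≈0 = begin
    y               ≈⟨ *-identityˡ y ⟨
    1# * y          ≈⟨ *-congʳ (*-inverseʳ x≉0) ⟨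
    x * x ⁻¹ * y    ≈⟨ solve 3 (λ x i y → x :* i :* y := i :* (x :* y)) refl x (x ⁻¹) y ⟩
    x ⁻¹ * (x * y)  ≈⟨ *-congˡ xy≈0 ⟩
    x ⁻¹ * 0#       ≈⟨ zeroʳ _ ⟩
    0#              ∎
    where open import Relation.Binary.Reasoning.Setoid setoid

  *-pos : ∀ {x y} → 0# < x → 0# < y → 0# < x * y
  *-pos x>0@(0≤x , _) y>0@(0≤y , _) = *-nonNeg 0≤x 0≤y , λ 0≈xy →
    <⇒≉0 y>0 (x*y≈0⇒y≈0 (<⇒≉0 x>0) (sym 0≈xy))

  -- The inverse of x equals x times the square of the inverse.
  ⁻¹-nonNeg : ∀ {x} → 0# < x → 0# ≤ x ⁻¹
  ⁻¹-nonNeg {x} x>0@(0≤x , _) = ≤-respʳ-≈ eq (*-nonNeg 0≤x (square-nonNeg (x ⁻¹)))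
    where
    eq : x * (x ⁻¹ * x ⁻¹) ≈ x ⁻¹
    eq = trans (sym (*-assoc _ _ _)) (trans (*-congʳ (*-inverseʳ (<⇒≉0 x>0))) (*-identityˡ _))

  0<1 : 0# < 1#
  0<1 = 0≤1 , λ 0≈1 → 1≉0 (sym 0≈1)

  0<2 : 0# < 2#
  0<2 = 0<x+y 0<1 0≤1

  0<4 : 0# < 4#
  0<4 = 0<x+y 0<2 (proj₁ 0<2)

  -- The expression is (2ct + b)²/4c. It serves twice: c = Cᵢ yields the term Rᵢ in the positivity
  -- of `Φ`, and c = Kᵢ yields dᵢdᵢ*/4Kᵢ when ξᵢ is eliminated.
  completeSquare : ∀ {c} → 0# < c → ∀ b t →
                   0# ≤ c * (t * t) + b * t + (4# * c) ⁻¹ * (b * b)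
  completeSquare {c} 0<c b t = ≤-respʳ-≈ eq
    (*-nonNeg (⁻¹-nonNeg 4c>0) (square-nonNeg (2# * c * t + b)))
    where
    4c>0 = *-pos 0<4 0<c
    κ = (4# * c) ⁻¹
    open import Relation.Binary.Reasoning.Setoid setoid
    eq : κ * ((2# * c * t + b) * (2# * c * t + b)) ≈ c * (t * t) + b * t + κ * (b * b)
    eq = begin
      κ * ((2# * c * t + b) * (2# * c * t + b))
        ≈⟨ solve 4 (λ κ c t b →
             κ :* ((2ᵖ :* c :* t :+ b) :* (2ᵖ :* c :* t :+ b)) :=
             (4ᵖ :* c :* κ) :* (c :* (t :* t) :+ b :* t) :+ κ :* (b :* b)) refl κ c t b ⟩
      (4# * c * κ) * (c * (t * t) + b * t) + κ * (b * b)
        ≈⟨ +-congʳ (trans (*-congʳ (*-inverseʳ (<⇒≉0 4c>0))) (*-identityˡ _)) ⟩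
      c * (t * t) + b * t + κ * (b * b) ∎

  ∑-mono-≤ : ∀ {n} {f g : Vector Carrier n} → (∀ i → f i ≤ g i) → sum f ≤ sum g
  ∑-mono-≤ {zero}  f≤g = ≤-refl
  ∑-mono-≤ {suc n} f≤g = +-mono-≤ (f≤g zero) (∑-mono-≤ (λ i → f≤g (suc i)))

  ∑-nonNeg : ∀ {n} {f : Vector Carrier n} → (∀ i → 0# ≤ f i) → 0# ≤ sum f
  ∑-nonNeg {n} 0≤f = ≤-respˡ-≈ (sum-replicate-zero n) (∑-mono-≤ 0≤f)

  ∑-zero : ∀ {n} {f : Vector Carrier n} → (∀ i → f i ≈ 0#) → sum f ≈ 0#
  ∑-zero {n} f≈0 = trans (sum-cong-≋ f≈0) (sum-replicate-zero n)

  ∑-nonNeg-zero : ∀ {n} {f : Vector Carrier n} → (∀ i → 0# ≤ f i) → sum f ≈ 0# → ∀ i → f i ≈ 0#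
  ∑-nonNeg-zero {suc n} {f} 0≤f ∑≈0 = λ where
      zero    → f₀≈0
      (suc i) → ∑-nonNeg-zero (λ i → 0≤f (suc i))
                  (trans (sym (+-identityˡ _)) (trans (+-congʳ (sym f₀≈0)) ∑≈0)) i
    where
    f₀≈0 : f zero ≈ 0#
    f₀≈0 = antisym (≤-respʳ-≈ ∑≈0 (≤-respˡ-≈ (+-identityʳ _)
                     (+-monoʳ-≤ (f zero) (∑-nonNeg (λ i → 0≤f (suc i)))))) (0≤f zero)

  ∑-distrib-- : ∀ {n} (f g : Vector Carrier n) →
                ∑[ i < n ] (f i - g i) ≈ sum f - sum g
  ∑-distrib-- {zero}  f g = sym (-‿inverseʳ 0#)
  ∑-distrib-- {suc n} f g = trans (+-congˡ (∑-distrib-- (λ i → f (suc i)) (λ i → g (suc i))))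
    (solve 4 (λ a b c d → (a :- b) :+ (c :- d) := (a :+ c) :- (b :+ d)) refl _ _ _ _)

-- Matrix algebra, quadratic forms and traces.

module MatrixProperties (ℝ : Reals) where
  open Reals ℝ hiding (zero)
  open OrderedField ℝ
  open LinearAlgebra ℝ
  open import Relation.Binary.Reasoning.Setoid setoid

  private variable
    l n r c : ℕ

  ⟨⟩-cong : {x x′ y y′ : Vector Carrier n} → (∀ i → x i ≈ x′ i) → (∀ i → y i ≈ y′ i) →
            ⟨ x , y ⟩ ≈ ⟨ x′ , y′ ⟩
  ⟨⟩-cong x≈x′ y≈y′ = sum-cong-≋ λ i → *-cong (x≈x′ i) (y≈y′ i)

  ⟨⟩-congˡ : (x : Vector Carrier n) {y y′ : Vector Carrier n} → (∀ i → y i ≈ y′ i) →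
             ⟨ x , y ⟩ ≈ ⟨ x , y′ ⟩
  ⟨⟩-congˡ x y≈y′ = ⟨⟩-cong {x = x} (λ _ → refl) y≈y′

  ⟨⟩-congʳ : (y : Vector Carrier n) {x x′ : Vector Carrier n} → (∀ i → x i ≈ x′ i) →
             ⟨ x , y ⟩ ≈ ⟨ x′ , y ⟩
  ⟨⟩-congʳ y x≈x′ = ⟨⟩-cong {y = y} x≈x′ (λ _ → refl)

  ⟨⟩-comm : (x y : Vector Carrier n) → ⟨ x , y ⟩ ≈ ⟨ y , x ⟩
  ⟨⟩-comm x y = sum-cong-≋ λ i → *-comm (x i) (y i)

  ⟨⟩-+ʳ : (x y z : Vector Carrier n) → ⟨ x , (λ i → y i + z i) ⟩ ≈ ⟨ x , y ⟩ + ⟨ x , z ⟩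
  ⟨⟩-+ʳ x y z = trans (sum-cong-≋ λ i → distribˡ (x i) (y i) (z i))
    (∑-distrib-+ (λ i → x i * y i) (λ i → x i * z i))

  ⟨⟩--ʳ : (x y z : Vector Carrier n) → ⟨ x , (λ i → y i - z i) ⟩ ≈ ⟨ x , y ⟩ - ⟨ x , z ⟩
  ⟨⟩--ʳ x y z = trans
    (sum-cong-≋ λ i → solve 3 (λ a b c → a :* (b :- c) := a :* b :- a :* c) refl (x i) (y i) (z i))
    (∑-distrib-- (λ i → x i * y i) (λ i → x i * z i))

  ⟨⟩-*ʳ : (k : Carrier) (x y : Vector Carrier n) → ⟨ x , (λ i → k * y i) ⟩ ≈ k * ⟨ x , y ⟩
  ⟨⟩-*ʳ k x y = trans
    (sum-cong-≋ λ i → solve 3 (λ k a b → a :* (k :* b) := k :* (a :* b)) refl k (x i) (y i))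
    (sym (*-distribˡ-sum k (λ i → x i * y i)))

  ⟨⟩-+ˡ : (x y z : Vector Carrier n) → ⟨ (λ i → x i + y i) , z ⟩ ≈ ⟨ x , z ⟩ + ⟨ y , z ⟩
  ⟨⟩-+ˡ x y z = trans (⟨⟩-comm _ z) (trans (⟨⟩-+ʳ z x y) (+-cong (⟨⟩-comm z x) (⟨⟩-comm z y)))

  ⟨⟩--ˡ : (x y z : Vector Carrier n) → ⟨ (λ i → x i - y i) , z ⟩ ≈ ⟨ x , z ⟩ - ⟨ y , z ⟩
  ⟨⟩--ˡ x y z = trans (⟨⟩-comm _ z)
    (trans (⟨⟩--ʳ z x y) (+-cong (⟨⟩-comm z x) (-‿cong (⟨⟩-comm z y))))

  ⟨⟩-*ˡ : (k : Carrier) (x y : Vector Carrier n) → ⟨ (λ i → k * x i) , y ⟩ ≈ k * ⟨ x , y ⟩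
  ⟨⟩-*ˡ k x y = trans (⟨⟩-comm _ y) (trans (⟨⟩-*ʳ k y x) (*-congˡ (⟨⟩-comm y x)))

  *ᵥ-congˡ : {A B : Matrix r c} (x : Vector Carrier c) → A ≋ B → ∀ i → (A *ᵥ x) i ≈ (B *ᵥ x) i
  *ᵥ-congˡ x A≋B i = ⟨⟩-congʳ x (A≋B i)

  *ᵥ-congʳ : (A : Matrix r c) {x y : Vector Carrier c} → (∀ i → x i ≈ y i) →
             ∀ i → (A *ᵥ x) i ≈ (A *ᵥ y) i
  *ᵥ-congʳ A x≈y i = ⟨⟩-congˡ (A i) x≈y

  *ᵥ-zero : (A : Matrix r c) {x : Vector Carrier c} → (∀ i → x i ≈ 0#) → ∀ i → (A *ᵥ x) i ≈ 0#
  *ᵥ-zero A x≈0 i = ∑-zero λ j → trans (*-congˡ (x≈0 j)) (zeroʳ _)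

  *ᵥ-∙ : (k : Carrier) (A : Matrix r c) (x : Vector Carrier c) →
         ∀ i → ((k ∙ A) *ᵥ x) i ≈ k * (A *ᵥ x) i
  *ᵥ-∙ k A x i = ⟨⟩-*ˡ k (A i) x

  *ᵥ-· : (A : Matrix r n) (B : Matrix n c) (x : Vector Carrier c) →
         ∀ i → ((A · B) *ᵥ x) i ≈ (A *ᵥ B *ᵥ x) i
  *ᵥ-· A B x i = begin
    ∑[ j < _ ] ((∑[ k < _ ] (A i k * B k j)) * x j)
      ≈⟨ sum-cong-≋ (λ j → *-distribʳ-sum (x j) (λ k → A i k * B k j)) ⟩
    ∑[ j < _ ] ∑[ k < _ ] (A i k * B k j * x j)
      ≈⟨ ∑-comm (λ j k → A i k * B k j * x j) ⟩
    ∑[ k < _ ] ∑[ j < _ ] (A i k * B k j * x j)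
      ≈⟨ sum-cong-≋ (λ k → trans (sum-cong-≋ λ j → *-assoc (A i k) (B k j) (x j))
                                (sym (*-distribˡ-sum (A i k) (λ j → B k j * x j)))) ⟩
    ∑[ k < _ ] (A i k * ∑[ j < _ ] (B k j * x j)) ∎

  ᵀ-*ᵥ-adjoint : (A : Matrix r c) (x : Vector Carrier c) (y : Vector Carrier r) →
                 ⟨ x , A ᵀ *ᵥ y ⟩ ≈ ⟨ A *ᵥ x , y ⟩
  ᵀ-*ᵥ-adjoint A x y = begin
    ∑[ i < _ ] (x i * ∑[ k < _ ] (A k i * y k))
      ≈⟨ sum-cong-≋ (λ i → *-distribˡ-sum (x i) (λ k → A k i * y k)) ⟩
    ∑[ i < _ ] ∑[ k < _ ] (x i * (A k i * y k))
      ≈⟨ ∑-comm (λ i k → x i * (A k i * y k)) ⟩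
    ∑[ k < _ ] ∑[ i < _ ] (x i * (A k i * y k))
      ≈⟨ sum-cong-≋ (λ k → trans
           (sum-cong-≋ λ i → solve 3 (λ x a y → x :* (a :* y) := a :* x :* y) refl (x i) (A k i) (y k))
           (sym (*-distribʳ-sum (y k) (λ i → A k i * x i)))) ⟩
    ∑[ k < _ ] ((∑[ i < _ ] (A k i * x i)) * y k) ∎

  outer-*ᵥ : (u : Vector Carrier r) (v x : Vector Carrier c) →
             ∀ i → (outer u v *ᵥ x) i ≈ ⟨ v , x ⟩ * u i
  outer-*ᵥ u v x i = trans (⟨⟩-*ˡ (u i) v x) (*-comm _ _)

  form-⊕ : (A B : Matrix n n) (x : Vector Carrier n) →
           ⟨ x , (A ⊕ B) *ᵥ x ⟩ ≈ ⟨ x , A *ᵥ x ⟩ + ⟨ x , B *ᵥ x ⟩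
  form-⊕ A B x = trans (⟨⟩-congˡ x (λ i → ⟨⟩-+ˡ (A i) (B i) x)) (⟨⟩-+ʳ x _ _)

  form-⊖ : (A B : Matrix n n) (x : Vector Carrier n) →
           ⟨ x , (A ⊖ B) *ᵥ x ⟩ ≈ ⟨ x , A *ᵥ x ⟩ - ⟨ x , B *ᵥ x ⟩
  form-⊖ A B x = trans (⟨⟩-congˡ x (λ i → ⟨⟩--ˡ (A i) (B i) x)) (⟨⟩--ʳ x _ _)

  form-∙ : (k : Carrier) (A : Matrix n n) (x : Vector Carrier n) →
           ⟨ x , (k ∙ A) *ᵥ x ⟩ ≈ k * ⟨ x , A *ᵥ x ⟩
  form-∙ k A x = trans (⟨⟩-congˡ x (*ᵥ-∙ k A x)) (⟨⟩-*ʳ k x _)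

  form-outer : (u v x : Vector Carrier n) → ⟨ x , outer u v *ᵥ x ⟩ ≈ ⟨ v , x ⟩ * ⟨ u , x ⟩
  form-outer u v x = trans (⟨⟩-congˡ x (outer-*ᵥ u v x))
    (trans (⟨⟩-*ʳ _ x u) (*-congˡ (⟨⟩-comm x u)))

  form-ᵀ· : (A : Matrix r n) (B : Matrix r n) (x : Vector Carrier n) →
            ⟨ x , (A ᵀ · B) *ᵥ x ⟩ ≈ ⟨ A *ᵥ x , B *ᵥ x ⟩
  form-ᵀ· A B x = trans (⟨⟩-congˡ x (*ᵥ-· (A ᵀ) B x)) (ᵀ-*ᵥ-adjoint A x (B *ᵥ x))

  form-ᵀ·· : (A : Matrix r n) (M : Matrix r l) (B : Matrix l n) (x : Vector Carrier n) →
             ⟨ x , (A ᵀ · M · B) *ᵥ x ⟩ ≈ ⟨ A *ᵥ x , M *ᵥ B *ᵥ x ⟩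
  form-ᵀ·· A M B x = trans (⟨⟩-congˡ x λ i →
    trans (*ᵥ-· (A ᵀ · M) B x i) (*ᵥ-· (A ᵀ) M (B *ᵥ x) i)) (ᵀ-*ᵥ-adjoint A x _)

  ∑-diagonal : (i : Fin n) (f : Vector Carrier n) →
               ∑[ k < n ] (if does (i ≟ k) then f k else 0#) ≈ f i
  ∑-diagonal {suc n} zero f = trans (+-congˡ (sum-replicate-zero n)) (+-identityʳ (f zero))
  ∑-diagonal (suc i) f = trans (+-identityˡ _) (∑-diagonal i (λ k → f (suc k)))

  ∑-supported : (i : Fin n) (f : Vector Carrier n) →
                (∀ k → k ≢ i → f k ≈ 0#) → sum f ≈ f i
  ∑-supported i f f≈0 = trans (sum-cong-≋ restrict) (∑-diagonal i f)
    where
    restrict : ∀ k → f k ≈ (if does (i ≟ k) then f k else 0#)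
    restrict k with i ≟ k
    ... | yes _   = refl
    ... | no  i≢k = f≈0 k (i≢k ∘ ≡.sym)

  if-* : (b : Bool) (x y : Carrier) →
         (if b then x else 0#) * y ≈ (if b then x * y else 0#)
  if-* true  x y = refl
  if-* false x y = zeroˡ y

  I-*ᵥ : (x : Vector Carrier n) → ∀ i → (I *ᵥ x) i ≈ x i
  I-*ᵥ x i = trans (sum-cong-≋ λ k → if-* (does (i ≟ k)) 1# (x k))
    (trans (∑-diagonal i _) (*-identityˡ (x i)))

  form-I : (x : Vector Carrier n) → ⟨ x , I *ᵥ x ⟩ ≈ ⟨ x , x ⟩
  form-I x = ⟨⟩-congˡ x (I-*ᵥ x)

  ·-congˡ : (A : Matrix r n) {B B′ : Matrix n c} → B ≋ B′ → A · B ≋ A · B′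
  ·-congˡ A B≋B′ i j = ⟨⟩-congˡ (A i) (λ k → B≋B′ k j)

  ·-congʳ : {A A′ : Matrix r n} (B : Matrix n c) → A ≋ A′ → A · B ≋ A′ · B
  ·-congʳ B A≋A′ i j = ⟨⟩-congʳ (λ k → B k j) (A≋A′ i)

  ·-assoc : (A : Matrix r n) (B : Matrix n l) (M : Matrix l c) → A · B · M ≋ A · (B · M)
  ·-assoc A B M i j = *ᵥ-· A B (λ k → M k j) i

  ·-identityˡ : (A : Matrix r c) → I · A ≋ A
  ·-identityˡ A i j = I-*ᵥ (λ k → A k j) i

  I-symmetric : Symmetric (I {n})
  I-symmetric i j with i ≟ j | j ≟ i
  ... | yes _      | yes _      = refl
  ... | yes ≡.refl | no  j≢i    = contradiction ≡.refl j≢i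
  ... | no  i≢j    | yes ≡.refl = contradiction ≡.refl i≢j
  ... | no  _      | no  _      = refl

  ᵀ-· : (A : Matrix r n) (B : Matrix n c) → (A · B) ᵀ ≋ B ᵀ · A ᵀ
  ᵀ-· A B i j = ⟨⟩-comm (A j) (λ k → B k i)

  ·-identityʳ : (A : Matrix r c) → A · I ≋ A
  ·-identityʳ A i j = begin
    (A · I) i j         ≈⟨ ᵀ-· A I j i ⟩
    (I ᵀ · A ᵀ) j i     ≈⟨ ·-congʳ (A ᵀ) I-symmetric j i ⟩
    (I · A ᵀ) j i       ≈⟨ ·-identityˡ (A ᵀ) j i ⟩
    A i j               ∎

  tr-cong : {A B : Matrix n n} → A ≋ B → tr A ≈ tr B
  tr-cong A≋B = sum-cong-≋ λ i → A≋B i i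

  tr-⊕ : (A B : Matrix n n) → tr (A ⊕ B) ≈ tr A + tr B
  tr-⊕ A B = ∑-distrib-+ (λ i → A i i) (λ i → B i i)

  tr-comm : (A : Matrix r c) (B : Matrix c r) → tr (A · B) ≈ tr (B · A)
  tr-comm A B = trans (∑-comm (λ i k → A i k * B k i))
    (sum-cong-≋ λ k → sum-cong-≋ λ i → *-comm (A i k) (B k i))

  -- A matrix and its transpose have the same quadratic form, hence so does their average.
  Sym-form : (A : Matrix 2 2) (x : Vector Carrier 2) → ⟨ x , Sym A *ᵥ x ⟩ ≈ ⟨ x , A *ᵥ x ⟩
  Sym-form A x = begin
    ⟨ x , Sym A *ᵥ x ⟩ ≈⟨ form-∙ (2# ⁻¹) (A ⊕ A ᵀ) x ⟩
    2# ⁻¹ * ⟨ x , (A ⊕ A ᵀ) *ᵥ x ⟩ ≈⟨ *-congˡ (form-⊕ A (A ᵀ) x) ⟩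
    2# ⁻¹ * (⟨ x , A *ᵥ x ⟩ + ⟨ x , A ᵀ *ᵥ x ⟩)
      ≈⟨ *-congˡ (+-congˡ (trans (ᵀ-*ᵥ-adjoint A x x) (⟨⟩-comm (A *ᵥ x) x))) ⟩
    2# ⁻¹ * (⟨ x , A *ᵥ x ⟩ + ⟨ x , A *ᵥ x ⟩)
      ≈⟨ solve 2 (λ i a → i :* (a :+ a) := 2ᵖ :* i :* a) refl (2# ⁻¹) ⟨ x , A *ᵥ x ⟩ ⟩
    2# * 2# ⁻¹ * ⟨ x , A *ᵥ x ⟩ ≈⟨ *-congʳ (*-inverseʳ (<⇒≉0 0<2)) ⟩
    1# * ⟨ x , A *ᵥ x ⟩ ≈⟨ *-identityˡ _ ⟩
    ⟨ x , A *ᵥ x ⟩ ∎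

-- Coordinate pairs and block-diagonal matrices.

module PairProperties (ℝ : Reals) where
  open Reals ℝ hiding (zero)
  open OrderedField ℝ
  open LinearAlgebra ℝ
  open MatrixProperties ℝ
  open import Relation.Binary.Reasoning.Setoid setoid

  private variable
    m : ℕ

  pair : Vector Carrier (m ℕ.* 2) → Fin m → Vector Carrier 2
  pair x i a = x (combine i a)

  -- Both `suc m ℕ.* 2` and `combine (suc i) a` compute to a shift by two, so each step of the
  -- recursion peels off one pair without any transport of indices.
  ∑-pairs : (f : Vector Carrier (m ℕ.* 2)) →
            sum f ≈ ∑[ i < m ] ∑[ a < 2 ] f (combine i a)
  ∑-pairs {zero}  f = refl
  ∑-pairs {suc m} f = trans (+-congˡ (+-congˡ (∑-pairs {m} (λ p → f (suc (suc p))))))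
    (solve 3 (λ a b c → a :+ (b :+ c) := (a :+ (b :+ con (+ 0))) :+ c) refl _ _ _)

  ⟨⟩-pairs : (x y : Vector Carrier (m ℕ.* 2)) →
             ⟨ x , y ⟩ ≈ ∑[ i < m ] ⟨ pair x i , pair y i ⟩
  ⟨⟩-pairs {m} x y = ∑-pairs {m} (λ p → x p * y p)

  ≈-byPairs : ∀ {x y : Vector Carrier (m ℕ.* 2)} → (∀ i a → pair {m} x i a ≈ pair y i a) → ∀ p → x p ≈ y p
  ≈-byPairs {m} {x} {y} x≈y p = ≡.subst (λ q → x q ≈ y q) (combine-remQuot {m} 2 p) (x≈y _ _)

  directSum-combine : (A : Fin m → Matrix 2 2) (i k : Fin m) (a b : Fin 2) →
    directSum A (combine i a) (combine k b) ≡.≡ (if does (i ≟ k) then A i a b else 0#)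
  directSum-combine {m} A i k a b = ≡.cong₂ entry (remQuot-combine i a) (remQuot-combine k b)
    where
    entry : Fin m × Fin 2 → Fin m × Fin 2 → Carrier
    entry (i , a) (k , b) = if does (i ≟ k) then A i a b else 0#

  directSum-*ᵥ : (A : Fin m → Matrix 2 2) (x : Vector Carrier (m ℕ.* 2)) →
    ∀ i a → pair (directSum A *ᵥ x) i a ≈ (A i *ᵥ pair x i) a
  directSum-*ᵥ {m} A x i a = begin
    ∑[ q < m ℕ.* 2 ] (directSum A (combine i a) q * x q)
      ≈⟨ ∑-pairs {m} (λ q → directSum A (combine i a) q * x q) ⟩
    ∑[ k < m ] ∑[ b < 2 ] (directSum A (combine i a) (combine k b) * pair x k b)
      ≈⟨ ∑-comm {m} {2} (λ k b → directSum A (combine i a) (combine k b) * pair x k b) ⟩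
    ∑[ b < 2 ] ∑[ k < m ] (directSum A (combine i a) (combine k b) * pair x k b)
      ≈⟨ sum-cong-≋ (λ b → trans
           (sum-cong-≋ λ k → trans (*-congʳ (reflexive (directSum-combine A i k a b)))
                                   (if-* (does (i ≟ k)) (A i a b) (pair x k b)))
           (∑-diagonal i (λ k → A i a b * pair x k b))) ⟩
    ∑[ b < 2 ] (A i a b * pair x i b) ∎

  directSum-ᵀ : (A : Fin m → Matrix 2 2) → directSum A ᵀ ≋ directSum (λ i → A i ᵀ)
  directSum-ᵀ {m} A p q = entry-ᵀ (remQuot {m} 2 p) (remQuot {m} 2 q)
    where
    entry-ᵀ : ((i , a) (k , b) : Fin m × Fin 2) →
              (if does (k ≟ i) then A k b a else 0#) ≈ (if does (i ≟ k) then A i b a else 0#)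
    entry-ᵀ (i , a) (k , b) with k ≟ i | i ≟ k
    ... | yes ≡.refl | yes _      = refl
    ... | yes ≡.refl | no  i≢k    = contradiction ≡.refl i≢k
    ... | no  k≢i    | yes ≡.refl = contradiction ≡.refl k≢i
    ... | no  _      | no _       = refl

  directSum-form : (A : Fin m → Matrix 2 2) (x : Vector Carrier (m ℕ.* 2)) →
    ⟨ x , directSum A *ᵥ x ⟩ ≈ ∑[ i < m ] ⟨ pair x i , A i *ᵥ pair x i ⟩
  directSum-form {m} A x = trans (⟨⟩-pairs {m} x (directSum A *ᵥ x))
    (sum-cong-≋ {m} λ i → ⟨⟩-congˡ (pair x i) (directSum-*ᵥ A x i))

  block-directSum : (A : Fin m → Matrix 2 2) (i : Fin m) → block (directSum A) i ≋ A i
  block-directSum A i a b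
    rewrite directSum-combine A i i a b | dec-true (i ≟ i) ≡.refl = refl

  -- Block-diagonal factors do not mix pairs, so only the i-th block of `M` survives. The two
  -- factors are moved across one after the other, each as a transposed direct sum acting on a
  -- vector.
  block-directSum-conjugate : (A B : Fin m → Matrix 2 2) (M : Matrix (m ℕ.* 2) (m ℕ.* 2)) →
    ∀ i → block (directSum A ᵀ · M · directSum B) i ≋ A i ᵀ · block M i · B i
  block-directSum-conjugate {m} A B M i a b = begin
    (directSum A ᵀ · M · directSum B) (combine i a) (combine i b)
      ≈⟨ ⟨⟩-comm ((directSum A ᵀ · M) (combine i a)) (λ q → directSum B q (combine i b)) ⟩
    pair (directSum B ᵀ *ᵥ (directSum A ᵀ · M) (combine i a)) i b
      ≈⟨ column-*ᵥ B ((directSum A ᵀ · M) (combine i a)) i b ⟩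
    (B i ᵀ *ᵥ pair ((directSum A ᵀ · M) (combine i a)) i) b
      ≈⟨ *ᵥ-congʳ (B i ᵀ) (λ e → column-*ᵥ A (λ p → M p (combine i e)) i a) b ⟩
    (B i ᵀ *ᵥ (A i ᵀ · block M i) a) b
      ≈⟨ ⟨⟩-comm (λ e → B i e b) ((A i ᵀ · block M i) a) ⟩
    (A i ᵀ · block M i · B i) a b ∎
    where
    column-*ᵥ : (A : Fin m → Matrix 2 2) (x : Vector Carrier (m ℕ.* 2)) → ∀ i a →
                pair (directSum A ᵀ *ᵥ x) i a ≈ (A i ᵀ *ᵥ pair x i) a
    column-*ᵥ A x i a = trans (*ᵥ-congˡ x (directSum-ᵀ A) (combine i a))
                              (directSum-*ᵥ (λ i → A i ᵀ) x i a)

-- A positive form of small trace on a subspace.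

module TraceBound (em : ExcludedMiddle 0ℓ) (ℝ : Reals) where
  open Reals ℝ hiding (zero)
  open OrderedField ℝ
  open LinearAlgebra ℝ
  open MatrixProperties ℝ
  open import Relation.Binary.Reasoning.Setoid setoid

  -- Inverses exist only for elements known to be nonzero, and real equality is not decidable;
  -- excluded middle supplies the case split.
  x*x≈0⇒x≈0 : ∀ {x} → x * x ≈ 0# → x ≈ 0#
  x*x≈0⇒x≈0 {x} x²≈0 with em {x ≈ 0#}
  ... | yes x≈0 = x≈0
  ... | no  x≉0 = x*y≈0⇒y≈0 x≉0 x²≈0

  -- Weaker than `PosSemidef`: symmetry is not demanded, because the form to which this is applied
  -- contains a term B*TW.
  PositiveForm : ∀ {n} → Matrix n n → Set
  PositiveForm M = ∀ x → 0# ≤ ⟨ x , M *ᵥ x ⟩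

  -- Linear independence of the columns of `G`.
  Injective : ∀ {r c} → Matrix r c → Set
  Injective G = ∀ ξ → (∀ p → (G *ᵥ ξ) p ≈ 0#) → ∀ i → ξ i ≈ 0#

  module _ {n} (c w : Vector Carrier n) (0≤c : ∀ p → 0# ≤ c p) (0≤w : ∀ p → 0# ≤ w p)
           (wc≈1 : ∀ p → w p * c p ≈ 1#) where

    normSq : Vector Carrier n → Carrier
    normSq x = ∑[ p < n ] (c p * (x p * x p))

    -- The trace of the form in the inner product with weights `c`: the vectors e_p/√c_p are
    -- orthonormal there, and the form takes the value M_pp/c_p on them. Using the reciprocals `w`
    -- keeps square roots out.
    weightedTr : Matrix n n → Carrier
    weightedTr M = ∑[ p < n ] (w p * M p p)

    normSq≈0⇒≈0 : ∀ x → normSq x ≈ 0# → ∀ p → x p ≈ 0#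
    normSq≈0⇒≈0 x eq p = x*x≈0⇒x≈0 (begin
      x p * x p                   ≈⟨ *-identityˡ _ ⟨
      1# * (x p * x p)            ≈⟨ *-congʳ (wc≈1 p) ⟨
      w p * c p * (x p * x p)     ≈⟨ *-assoc _ _ _ ⟩
      w p * (c p * (x p * x p))
        ≈⟨ *-congˡ (∑-nonNeg-zero (λ p → *-nonNeg (0≤c p) (square-nonNeg (x p))) eq p) ⟩
      w p * 0#                    ≈⟨ zeroʳ _ ⟩
      0#                          ∎)

    normSq-cong : ∀ {x y} → (∀ p → x p ≈ y p) → normSq x ≈ normSq y
    normSq-cong x≈y = sum-cong-≋ λ p → *-congˡ (*-cong (x≈y p) (x≈y p))

    weightedTr-nonNeg : ∀ M → PositiveForm M → 0# ≤ weightedTr M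
    weightedTr-nonNeg M M≥0 = ∑-nonNeg λ p → *-nonNeg (0≤w p) (≤-respʳ-≈ (diagonal p) (M≥0 (I p)))
      where
      diagonal : ∀ p → ⟨ I p , M *ᵥ I p ⟩ ≈ M p p
      diagonal p = trans (I-*ᵥ (M *ᵥ I p) p) (trans (⟨⟩-comm (M p) (I p)) (I-*ᵥ (M p) p))

    -- The form x ↦ M(Qx) for Q the orthogonal projection, in the inner product
    -- with weights c, along g.
    module Deflation (M : Matrix n n) (M≥0 : PositiveForm M) (g : Vector Carrier n)
                     (g≉0 : ¬ (∀ p → g p ≈ 0#)) where

      s = normSq g
      σ = s ⁻¹
      β = ⟨ g , M *ᵥ g ⟩

      s≉0 : s ≉ 0#
      s≉0 s≈0 = g≉0 (normSq≈0⇒≈0 g s≈0)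

      0<s : 0# < s
      0<s = ∑-nonNeg (λ p → *-nonNeg (0≤c p) (square-nonNeg (g p))) , λ 0≈s → s≉0 (sym 0≈s)

      sσ≈1 : s * σ ≈ 1#
      sσ≈1 = *-inverseʳ s≉0

      -- `a` represents the weighted product with g, so that σ⟨a , x⟩g is the projection of x onto
      -- g. As `M` may be asymmetric, its left and right actions on g need the separate vectors `u`
      -- and `v`.
      a u v : Vector Carrier n
      a p = c p * g p
      u p = σ * (M ᵀ *ᵥ g) p
      v p = σ * (M *ᵥ g) p

      τ = σ * σ * β

      -- Q*MQ multiplied out for Q = I - σga*, the matrix of `projectOff`. The explicit sum of
      -- rank-one corrections is what makes the trace computable entry by entry.
      deflate : Matrix n n
      deflate = M ⊖ outer a u ⊖ outer v a ⊕ (τ ∙ outer a a)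

      projectOff : Vector Carrier n → Vector Carrier n
      projectOff x p = x p - σ * ⟨ a , x ⟩ * g p

      ⟨a,g⟩≈s : ⟨ a , g ⟩ ≈ s
      ⟨a,g⟩≈s = sum-cong-≋ λ p → *-assoc (c p) (g p) (g p)

      ⟨a,projectOff⟩≈0 : ∀ x → ⟨ a , projectOff x ⟩ ≈ 0#
      ⟨a,projectOff⟩≈0 x = begin
        ⟨ a , projectOff x ⟩
          ≈⟨ ⟨⟩--ʳ a x _ ⟩
        ⟨ a , x ⟩ - ⟨ a , (λ p → σ * ⟨ a , x ⟩ * g p) ⟩
          ≈⟨ +-congˡ (-‿cong (trans (⟨⟩-*ʳ _ a g) (*-congˡ ⟨a,g⟩≈s))) ⟩
        ⟨ a , x ⟩ - σ * ⟨ a , x ⟩ * s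
          ≈⟨ solve 3 (λ α σ s → α :- σ :* α :* s := α :* (1ᵖ :- s :* σ)) refl ⟨ a , x ⟩ σ s ⟩
        ⟨ a , x ⟩ * (1# - s * σ)
          ≈⟨ *-congˡ (trans (+-congˡ (-‿cong sσ≈1)) (-‿inverseʳ 1#)) ⟩
        ⟨ a , x ⟩ * 0#
          ≈⟨ zeroʳ _ ⟩
        0# ∎

      deflate-form : ∀ x → ⟨ x , deflate *ᵥ x ⟩ ≈
        ⟨ x , M *ᵥ x ⟩ - ⟨ a , x ⟩ * (σ * (⟨ M *ᵥ x , g ⟩ + ⟨ x , M *ᵥ g ⟩))
                       + τ * (⟨ a , x ⟩ * ⟨ a , x ⟩)
      deflate-form x = begin
        ⟨ x , deflate *ᵥ x ⟩
          ≈⟨ form-⊕ (M ⊖ outer a u ⊖ outer v a) (τ ∙ outer a a) x ⟩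
        ⟨ x , (M ⊖ outer a u ⊖ outer v a) *ᵥ x ⟩ + ⟨ x , (τ ∙ outer a a) *ᵥ x ⟩
          ≈⟨ +-cong (trans (form-⊖ (M ⊖ outer a u) (outer v a) x)
                           (+-congʳ (form-⊖ M (outer a u) x)))
                    (form-∙ τ (outer a a) x) ⟩
        ⟨ x , M *ᵥ x ⟩ - ⟨ x , outer a u *ᵥ x ⟩ - ⟨ x , outer v a *ᵥ x ⟩
          + τ * ⟨ x , outer a a *ᵥ x ⟩
          ≈⟨ +-cong (+-cong (+-congˡ (-‿cong (trans (form-outer a u x) (*-congʳ ux))))
                            (-‿cong (trans (form-outer v a x) (*-congˡ vx))))
                    (*-congˡ (form-outer a a x)) ⟩
        ⟨ x , M *ᵥ x ⟩ - σ * ⟨ M *ᵥ x , g ⟩ * ⟨ a , x ⟩ - ⟨ a , x ⟩ * (σ * ⟨ x , M *ᵥ g ⟩)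
          + τ * (⟨ a , x ⟩ * ⟨ a , x ⟩)
          ≈⟨ solve 6 (λ m σ l α k t →
               m :- σ :* l :* α :- α :* (σ :* k) :+ t := m :- α :* (σ :* (l :+ k)) :+ t)
               refl _ σ _ ⟨ a , x ⟩ _ _ ⟩
        ⟨ x , M *ᵥ x ⟩ - ⟨ a , x ⟩ * (σ * (⟨ M *ᵥ x , g ⟩ + ⟨ x , M *ᵥ g ⟩))
          + τ * (⟨ a , x ⟩ * ⟨ a , x ⟩) ∎
        where
        ux : ⟨ u , x ⟩ ≈ σ * ⟨ M *ᵥ x , g ⟩
        ux = trans (⟨⟩-*ˡ σ (M ᵀ *ᵥ g) x)
          (*-congˡ (trans (⟨⟩-comm (M ᵀ *ᵥ g) x) (ᵀ-*ᵥ-adjoint M x g)))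
        vx : ⟨ v , x ⟩ ≈ σ * ⟨ x , M *ᵥ g ⟩
        vx = trans (⟨⟩-*ˡ σ (M *ᵥ g) x) (*-congˡ (⟨⟩-comm (M *ᵥ g) x))

      deflate-form-projectOff : ∀ x → ⟨ projectOff x , M *ᵥ projectOff x ⟩ ≈ ⟨ x , deflate *ᵥ x ⟩
      deflate-form-projectOff x = begin
        ⟨ projectOff x , M *ᵥ projectOff x ⟩
          ≈⟨ ⟨⟩-congˡ (projectOff x) M-projectOff ⟩
        ⟨ projectOff x , (λ p → (M *ᵥ x) p - λ′ * (M *ᵥ g) p) ⟩
          ≈⟨ trans (⟨⟩--ˡ x (λ p → λ′ * g p) _) (+-congˡ (-‿cong (⟨⟩-*ˡ λ′ g _))) ⟩
        ⟨ x , (λ p → (M *ᵥ x) p - λ′ * (M *ᵥ g) p) ⟩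
          - λ′ * ⟨ g , (λ p → (M *ᵥ x) p - λ′ * (M *ᵥ g) p) ⟩
          ≈⟨ +-cong (split x) (-‿cong (*-congˡ (split g))) ⟩
        (⟨ x , M *ᵥ x ⟩ - λ′ * ⟨ x , M *ᵥ g ⟩) - λ′ * (⟨ g , M *ᵥ x ⟩ - λ′ * β)
          ≈⟨ +-congˡ (-‿cong (*-congˡ (+-congʳ (⟨⟩-comm g (M *ᵥ x))))) ⟩
        (⟨ x , M *ᵥ x ⟩ - λ′ * ⟨ x , M *ᵥ g ⟩) - λ′ * (⟨ M *ᵥ x , g ⟩ - λ′ * β)
          ≈⟨ solve 6 (λ m k l σ α β →
               (m :- σ :* α :* k) :- σ :* α :* (l :- σ :* α :* β) :=
               m :- α :* (σ :* (l :+ k)) :+ σ :* σ :* β :* (α :* α))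
               refl _ ⟨ x , M *ᵥ g ⟩ ⟨ M *ᵥ x , g ⟩ σ ⟨ a , x ⟩ β ⟩
        ⟨ x , M *ᵥ x ⟩ - ⟨ a , x ⟩ * (σ * (⟨ M *ᵥ x , g ⟩ + ⟨ x , M *ᵥ g ⟩))
          + τ * (⟨ a , x ⟩ * ⟨ a , x ⟩)
          ≈⟨ deflate-form x ⟨
        ⟨ x , deflate *ᵥ x ⟩ ∎
        where
        λ′ = σ * ⟨ a , x ⟩
        M-projectOff : ∀ p → (M *ᵥ projectOff x) p ≈ (M *ᵥ x) p - λ′ * (M *ᵥ g) p
        M-projectOff p = trans (⟨⟩--ʳ (M p) x (λ q → λ′ * g q)) (+-congˡ (-‿cong (⟨⟩-*ʳ λ′ (M p) g)))
        split : ∀ z → ⟨ z , (λ p → (M *ᵥ x) p - λ′ * (M *ᵥ g) p) ⟩ ≈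
                      ⟨ z , M *ᵥ x ⟩ - λ′ * ⟨ z , M *ᵥ g ⟩
        split z = trans (⟨⟩--ʳ z (M *ᵥ x) _) (+-congˡ (-‿cong (⟨⟩-*ʳ λ′ z (M *ᵥ g))))

      deflate-positive : PositiveForm deflate
      deflate-positive x = ≤-respʳ-≈ (deflate-form-projectOff x) (M≥0 (projectOff x))

      deflate-form-orthogonal : ∀ x → ⟨ a , x ⟩ ≈ 0# → ⟨ x , deflate *ᵥ x ⟩ ≈ ⟨ x , M *ᵥ x ⟩
      deflate-form-orthogonal x ax≈0 = begin
        ⟨ x , deflate *ᵥ x ⟩ ≈⟨ deflate-form x ⟩
        ⟨ x , M *ᵥ x ⟩ - ⟨ a , x ⟩ * z + τ * (⟨ a , x ⟩ * ⟨ a , x ⟩)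
          ≈⟨ +-cong (+-congˡ (-‿cong (*-congʳ ax≈0))) (*-congˡ (*-congʳ ax≈0)) ⟩
        ⟨ x , M *ᵥ x ⟩ - 0# * z + τ * (0# * ⟨ a , x ⟩)
          ≈⟨ solve 4 (λ m z t α → m :- con (+ 0) :* z :+ t :* (con (+ 0) :* α) := m)
               refl _ z τ ⟨ a , x ⟩ ⟩
        ⟨ x , M *ᵥ x ⟩ ∎
        where z = σ * (⟨ M *ᵥ x , g ⟩ + ⟨ x , M *ᵥ g ⟩)

      -- In an orthonormal basis that contains g/√s, passing to Q*MQ erases just the contribution
      -- β/s of that vector. In coordinates, each of the two cross terms removes `σ * β` and the `τ`
      -- term restores it once.
      weightedTr-deflate : weightedTr deflate ≈ weightedTr M - σ * β
      weightedTr-deflate = begin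
        ∑[ p < n ] (w p * deflate p p)
          ≈⟨ sum-cong-≋ entry ⟩
        ∑[ p < n ] (w p * M p p + (τ * (a p * g p) - (g p * u p + g p * v p)))
          ≈⟨ trans (∑-distrib-+ (λ p → w p * M p p) (λ p → τ * (a p * g p) - (g p * u p + g p * v p)))
               (+-congˡ (trans (∑-distrib-- (λ p → τ * (a p * g p)) (λ p → g p * u p + g p * v p))
                 (+-cong (sym (*-distribˡ-sum τ (λ p → a p * g p)))
                         (-‿cong (∑-distrib-+ (λ p → g p * u p) (λ p → g p * v p)))))) ⟩
        weightedTr M + (τ * ⟨ a , g ⟩ - (⟨ g , u ⟩ + ⟨ g , v ⟩))
          ≈⟨ +-congˡ (+-cong (*-congˡ ⟨a,g⟩≈s) (-‿cong (+-cong gu (⟨⟩-*ʳ σ g (M *ᵥ g))))) ⟩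
        weightedTr M + (σ * σ * β * s - (σ * β + σ * β))
          ≈⟨ solve 4 (λ t σ β s → t :+ (σ :* σ :* β :* s :- (σ :* β :+ σ :* β)) :=
               t :+ (s :* σ :* (σ :* β) :- (σ :* β :+ σ :* β))) refl _ σ β s ⟩
        weightedTr M + (s * σ * (σ * β) - (σ * β + σ * β))
          ≈⟨ +-congˡ (+-congʳ (*-congʳ sσ≈1)) ⟩
        weightedTr M + (1# * (σ * β) - (σ * β + σ * β))
          ≈⟨ solve 2 (λ t k → t :+ (1ᵖ :* k :- (k :+ k)) := t :- k) refl _ (σ * β) ⟩
        weightedTr M - σ * β ∎
        where
        gu : ⟨ g , u ⟩ ≈ σ * β
        gu = trans (⟨⟩-*ʳ σ g (M ᵀ *ᵥ g)) (*-congˡ (trans (ᵀ-*ᵥ-adjoint M g g) (⟨⟩-comm (M *ᵥ g) g)))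
        entry : ∀ p → w p * deflate p p ≈
                      w p * M p p + (τ * (a p * g p) - (g p * u p + g p * v p))
        entry p = begin
          w p * (M p p - c p * g p * u p - v p * (c p * g p) + τ * (c p * g p * (c p * g p)))
            ≈⟨ solve 7 (λ w m c g u v t →
                 w :* (m :- c :* g :* u :- v :* (c :* g) :+ t :* (c :* g :* (c :* g))) :=
                 w :* m :+ w :* c :* (t :* (c :* g :* g) :- (g :* u :+ g :* v)))
                 refl (w p) (M p p) (c p) (g p) (u p) (v p) τ ⟩
          w p * M p p + w p * c p * (τ * (a p * g p) - (g p * u p + g p * v p))
            ≈⟨ +-congˡ (trans (*-congʳ (wc≈1 p)) (*-identityˡ _)) ⟩
          w p * M p p + (τ * (a p * g p) - (g p * u p + g p * v p)) ∎

    basis₀ : ∀ {k} → Vector Carrier (suc k)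
    basis₀ = 1# ∷ λ _ → 0#

    module _ {k} (G : Matrix n (suc k)) where

      column₀ : Vector Carrier n
      column₀ p = G p zero

      G-basis₀ : ∀ p → (G *ᵥ basis₀) p ≈ column₀ p
      G-basis₀ p = trans (+-cong (*-identityʳ _) (∑-zero λ i → zeroʳ (G p (suc i)))) (+-identityʳ _)

      column₀≉0 : Injective G → ¬ (∀ p → column₀ p ≈ 0#)
      column₀≉0 G-inj g≈0 = 1≉0 (G-inj basis₀ (λ p → trans (G-basis₀ p) (g≈0 p)) zero)

    column₀-witness : ∀ {k} (M : Matrix n n) (G : Matrix n (suc k)) →
      ⟨ column₀ G , M *ᵥ column₀ G ⟩ ≤ normSq (column₀ G) →
      ∃[ ξ ] ¬ (∀ i → ξ i ≈ 0#) × ⟨ G *ᵥ ξ , M *ᵥ G *ᵥ ξ ⟩ ≤ normSq (G *ᵥ ξ)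
    column₀-witness M G le = basis₀ , (λ e≈0 → 1≉0 (e≈0 zero)) ,
      ≤-respˡ-≈ (sym (⟨⟩-cong (G-basis₀ G) (*ᵥ-congʳ M (G-basis₀ G))))
        (≤-respʳ-≈ (sym (normSq-cong (G-basis₀ G))) le)

    -- If the form does not drop below the norm at the first column g, deflating
    -- along g removes at least 1 from the weighted trace, and the remaining
    -- columns are projected onto the orthogonal complement of g.
    form≤normSq : ∀ k (M : Matrix n n) (G : Matrix n (suc k)) → PositiveForm M → Injective G →
                  weightedTr M ≤ ∑[ _ < suc k ] 1# →
                  ∃[ ξ ] ¬ (∀ i → ξ i ≈ 0#) × ⟨ G *ᵥ ξ , M *ᵥ G *ᵥ ξ ⟩ ≤ normSq (G *ᵥ ξ)
    form≤normSq k M G M≥0 G-inj tr≤ with total β s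
      where open Deflation M M≥0 (column₀ G) (column₀≉0 G G-inj)
    ... | inj₁ β≤s = column₀-witness M G β≤s
    form≤normSq zero M G M≥0 G-inj tr≤ | inj₂ _ = column₀-witness M G β≤s
      where
      open Deflation M M≥0 (column₀ G) (column₀≉0 G G-inj)
      -- With a single column the trace of `M` is at most 1. The deflated form is positive and so
      -- still has a nonnegative trace, hence the amount `σ * β` removed is at most 1.
      σβ≤1 : σ * β ≤ 1#
      σβ≤1 = ≤-trans (0≤-⇒≤ (≤-respʳ-≈ weightedTr-deflate (weightedTr-nonNeg deflate deflate-positive)))
                     (≤-respʳ-≈ (+-identityʳ 1#) tr≤)
      β≤s : β ≤ s
      β≤s = ≤-respˡ-≈ (trans (sym (*-assoc s σ β)) (trans (*-congʳ sσ≈1) (*-identityˡ β)))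
              (≤-respʳ-≈ (*-identityʳ s) (*-monoˡ-≤-nonNeg (proj₁ 0<s) σβ≤1))
    form≤normSq (suc k) M G M≥0 G-inj tr≤ | inj₂ s≤β
      = lift (form≤normSq k deflate G′ deflate-positive G′-inj tr′≤)
      where
      open Deflation M M≥0 (column₀ G) (column₀≉0 G G-inj)
      G′ : Matrix n (suc k)
      G′ p i = projectOff (λ q → G q (suc i)) p

      -- Each column of `G′` is a column of `G` minus a multiple of the first one. The new leading
      -- coefficient collects these multiples, so that `G` reproduces what `G′` does with η.
      extend : Vector Carrier (suc k) → Vector Carrier (suc (suc k))
      extend η = (- ∑[ i < suc k ] (σ * ⟨ a , (λ q → G q (suc i)) ⟩ * η i)) ∷ η

      G-extend : ∀ η p → (G *ᵥ extend η) p ≈ (G′ *ᵥ η) p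
      G-extend η p = sym (begin
        ∑[ i < suc k ] ((G p (suc i) - γ i * G p zero) * η i)
          ≈⟨ sum-cong-≋ (λ i → solve 4 (λ b γ g η → (b :- γ :* g) :* η := b :* η :- g :* (γ :* η))
               refl (G p (suc i)) (γ i) (G p zero) (η i)) ⟩
        ∑[ i < suc k ] (G p (suc i) * η i - G p zero * (γ i * η i))
          ≈⟨ trans (∑-distrib-- (λ i → G p (suc i) * η i) (λ i → G p zero * (γ i * η i)))
               (+-congˡ (-‿cong (sym (*-distribˡ-sum (G p zero) (λ i → γ i * η i))))) ⟩
        ∑[ i < suc k ] (G p (suc i) * η i) - G p zero * ∑[ i < suc k ] (γ i * η i)
          ≈⟨ solve 3 (λ x g y → x :- g :* y := g :* (:- y) :+ x) refl _ (G p zero) _ ⟩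
        G p zero * - (∑[ i < suc k ] (γ i * η i)) + ∑[ i < suc k ] (G p (suc i) * η i) ∎)
        where
        γ : Vector Carrier (suc k)
        γ i = σ * ⟨ a , (λ q → G q (suc i)) ⟩

      G′-inj : Injective G′
      G′-inj η G′η≈0 i = G-inj (extend η) (λ p → trans (G-extend η p) (G′η≈0 p)) (suc i)

      tr′≤ : weightedTr deflate ≤ ∑[ _ < suc k ] 1#
      tr′≤ = ≤-respˡ-≈ (sym weightedTr-deflate) (≤-byDifference _
        (+-nonNeg (≤⇒0≤- tr≤) (≤⇒0≤- 1≤σβ))
        (solve 4 (λ r t k o → r :- (t :- k) := ((o :+ r) :- t) :+ (k :- o)) refl _ _ (σ * β) 1#))
        where
        1≤σβ : 1# ≤ σ * β
        1≤σβ = ≤-respˡ-≈ (trans (*-comm σ s) sσ≈1) (*-monoˡ-≤-nonNeg (⁻¹-nonNeg 0<s) s≤β)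

      G′-orthogonal : ∀ η → ⟨ a , G′ *ᵥ η ⟩ ≈ 0#
      G′-orthogonal η = begin
        ⟨ a , G′ *ᵥ η ⟩      ≈⟨ ⟨⟩-comm a (G′ *ᵥ η) ⟩
        ⟨ G′ *ᵥ η , a ⟩      ≈⟨ ᵀ-*ᵥ-adjoint G′ η a ⟨
        ⟨ η , G′ ᵀ *ᵥ a ⟩
          ≈⟨ ∑-zero (λ i → trans (*-congˡ (trans (⟨⟩-comm ((G′ ᵀ) i) a)
               (⟨a,projectOff⟩≈0 (λ q → G q (suc i))))) (zeroʳ (η i))) ⟩
        0#                   ∎

      -- The vectors G′η are orthogonal to g, where the deflated form agrees with `M`, and they lie
      -- in the range of `G`. Hence a witness for the smaller problem is one for the larger.
      lift : ∃[ η ] ¬ (∀ i → η i ≈ 0#) × ⟨ G′ *ᵥ η , deflate *ᵥ G′ *ᵥ η ⟩ ≤ normSq (G′ *ᵥ η) →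
             ∃[ ξ ] ¬ (∀ i → ξ i ≈ 0#) × ⟨ G *ᵥ ξ , M *ᵥ G *ᵥ ξ ⟩ ≤ normSq (G *ᵥ ξ)
      lift (η , η≉0 , le) = extend η , (λ ξ≈0 → η≉0 (λ i → ξ≈0 (suc i))) ,
        ≤-respˡ-≈ (trans (deflate-form-orthogonal (G′ *ᵥ η) (G′-orthogonal η))
                     (sym (⟨⟩-cong (G-extend η) (*ᵥ-congʳ M (G-extend η)))))
          (≤-respʳ-≈ (sym (normSq-cong (G-extend η))) le)

-- The fair coin as a probability space.

module FairCoin (em : ExcludedMiddle 0ℓ) (ℝ : Reals) where
  open Reals ℝ hiding (zero)
  open OrderedField ℝ
  open Probability ℝ

  ½ : Carrier
  ½ = 2# ⁻¹

  0≤½ : 0# ≤ ½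
  0≤½ = ⁻¹-nonNeg 0<2

  mean : (Bool → Carrier) → Carrier
  mean f = ½ * (f false + f true)

  mean-mono-≤ : ∀ {f g} → (∀ ω → f ω ≤ g ω) → mean f ≤ mean g
  mean-mono-≤ f≤g = *-monoˡ-≤-nonNeg 0≤½ (+-mono-≤ (f≤g false) (f≤g true))

  mean-cong : ∀ {f g} → (∀ ω → f ω ≈ g ω) → mean f ≈ mean g
  mean-cong f≈g = *-congˡ (+-cong (f≈g false) (f≈g true))

  mean-const : ∀ x → mean (λ _ → x) ≈ x
  mean-const x = begin
    ½ * (x + x)    ≈⟨ solve 2 (λ h x → h :* (x :+ x) := 2ᵖ :* h :* x) refl ½ x ⟩
    2# * ½ * x     ≈⟨ *-congʳ (*-inverseʳ (<⇒≉0 0<2)) ⟩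
    1# * x         ≈⟨ *-identityˡ x ⟩
    x              ∎
    where open import Relation.Binary.Reasoning.Setoid setoid

  -- Every predicate on `Bool` is taken as an event, so membership has to be decided classically.
  indicator : Pred Bool 0ℓ → Bool → Carrier
  indicator A ω with em {A ω}
  ... | yes _ = 1#
  ... | no  _ = 0#

  indicator-∈ : ∀ {A ω} → ω ∈ A → indicator A ω ≈ 1#
  indicator-∈ {A} {ω} ω∈A with em {A ω}
  ... | yes _  = refl
  ... | no ω∉A = contradiction ω∈A ω∉A

  indicator-∉ : ∀ {A ω} → ω ∉ A → indicator A ω ≈ 0#
  indicator-∉ {A} {ω} ω∉A with em {A ω}
  ... | yes ω∈A = contradiction ω∈A ω∉A
  ... | no _    = refl

  indicator-nonNeg : ∀ A ω → 0# ≤ indicator A ω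
  indicator-nonNeg A ω with em {A ω}
  ... | yes _ = 0≤1
  ... | no  _ = ≤-refl

  indicator-≐ : ∀ {A B} → A ≐ B → ∀ ω → indicator A ω ≈ indicator B ω
  indicator-≐ {A} {B} (A⊆B , B⊆A) ω with em {A ω}
  ... | yes ω∈A = sym (indicator-∈ {B} (A⊆B ω∈A))
  ... | no  ω∉A = sym (indicator-∉ {B} (ω∉A ∘ B⊆A))

  -- At most one of the disjoint events contains ω, so at most one term survives. This bounds the
  -- partial sums in countable additivity as well as the lower sums of an integral.
  disjoint-∑-≤ : ∀ {n} (A : Fin n → Pred Bool 0ℓ) (c : Vector Carrier n) {x} ω →
                 (∀ k l → k ≢ l → A k ⊥ A l) → 0# ≤ x → (∀ k → ω ∈ A k → c k ≤ x) →
                 ∑[ k < n ] (c k * indicator (A k) ω) ≤ x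
  disjoint-∑-≤ {zero}  A c ω A⊥ 0≤x c≤x = 0≤x
  disjoint-∑-≤ {suc n} A c ω A⊥ 0≤x c≤x with em {A zero ω}
  ... | yes ω∈A₀ = ≤-respˡ-≈ (sym (trans (+-cong (*-identityʳ _) (∑-zero rest≈0)) (+-identityʳ _)))
                     (c≤x zero ω∈A₀)
    where
    rest≈0 : ∀ k → c (suc k) * indicator (A (suc k)) ω ≈ 0#
    rest≈0 k = trans
      (*-congˡ (indicator-∉ {A (suc k)} λ ω∈Aₖ → A⊥ zero (suc k) (λ ()) (ω∈A₀ , ω∈Aₖ)))
      (zeroʳ _)
  ... | no _ = ≤-respˡ-≈ (sym (trans (+-congʳ (zeroʳ _)) (+-identityˡ _)))
    (disjoint-∑-≤ (A ∘ suc) (c ∘ suc) ω (λ k l k≢l → A⊥ (suc k) (suc l) (k≢l ∘ suc-injective))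
      0≤x (c≤x ∘ suc))

  ∑-mean : ∀ {n} (c : Vector Carrier n) (f : Fin n → Bool → Carrier) →
           ∑[ k < n ] (c k * mean (f k)) ≈ mean (λ ω → ∑[ k < n ] (c k * f k ω))
  ∑-mean c f = trans
    (sum-cong-≋ λ k → solve 4 (λ c h x y → c :* (h :* (x :+ y)) := h :* (c :* x :+ c :* y))
      refl (c k) ½ (f k false) (f k true))
    (trans (sym (*-distribˡ-sum ½ (λ k → c k * f k false + c k * f k true)))
      (*-congˡ (∑-distrib-+ (λ k → c k * f k false) (λ k → c k * f k true))))

  term-≤-∑ : ∀ {n} {f : Vector Carrier n} → (∀ k → 0# ≤ f k) → ∀ k → f k ≤ sum f
  term-≤-∑ {suc n} {f} 0≤f zero =
    ≤-respˡ-≈ (+-identityʳ _) (+-monoʳ-≤ (f zero) (∑-nonNeg (0≤f ∘ suc)))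
  term-≤-∑ {suc n} {f} 0≤f (suc k) =
    ≤-respˡ-≈ (+-identityˡ _) (+-mono-≤ (0≤f zero) (term-≤-∑ (0≤f ∘ suc) k))

  P : Pred Bool 0ℓ → Carrier
  P A = mean (indicator A)

  P-U : P Univ ≈ 1#
  P-U = trans (mean-cong (λ ω → indicator-∈ {Univ} {ω} tt)) (mean-const 1#)

  module _ (A : ℕ → Pred Bool 0ℓ) where

    -- The factor `1#` gives the summands the shape c · indicator shared by `disjoint-∑-≤` and
    -- `∑-mean`.
    partialSum : ℕ → Bool → Carrier
    partialSum n ω = ∑[ k < n ] (1# * indicator (A (toℕ k)) ω)

    ∑-P : ∀ n → ∑[ k < n ] P (A (toℕ k)) ≈ mean (partialSum n)
    ∑-P n = trans (sum-cong-≋ λ k → sym (*-identityˡ (P (A (toℕ {n} k)))))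
      (∑-mean (λ _ → 1#) (λ k → indicator (A (toℕ {n} k))))

    partialSum-≤ : (∀ k l → k ≢ l → A k ⊥ A l) → ∀ n ω → partialSum n ω ≤ indicator (⋃ ℕ A) ω
    partialSum-≤ A⊥ n ω = disjoint-∑-≤ (A ∘ toℕ {n}) (λ _ → 1#) ω
      (λ k l k≢l → A⊥ (toℕ k) (toℕ l) (k≢l ∘ toℕ-injective))
      (indicator-nonNeg (⋃ ℕ A) ω)
      (λ k ω∈Aₖ → ≤-reflexive (sym (indicator-∈ {⋃ ℕ A} (toℕ k , ω∈Aₖ))))

    partialSum-nonNeg : ∀ n ω (k : Fin n) → 0# ≤ 1# * indicator (A (toℕ k)) ω
    partialSum-nonNeg n ω k = *-nonNeg 0≤1 (indicator-nonNeg (A (toℕ k)) ω)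

    -- An outcome in the union lies in some Aⱼ, and from stage j + 1 on the partial sums contain its
    -- term.
    partialSum-attains : ∀ ω → ∃[ b ] ∀ n → b ℕ.≤ n → indicator (⋃ ℕ A) ω ≤ partialSum n ω
    partialSum-attains ω with em {ω ∈ ⋃ ℕ A}
    ... | no  _ = 0 , λ n _ → ∑-nonNeg (partialSum-nonNeg n ω)
    ... | yes (j , ω∈Aⱼ) = suc j , λ n j<n → ≤-respˡ-≈
            (trans (*-identityˡ _)
              (indicator-∈ {A (toℕ (fromℕ< j<n))}
                (≡.subst (λ i → A i ω) (≡.sym (toℕ-fromℕ< j<n)) ω∈Aⱼ)))
            (term-≤-∑ (partialSum-nonNeg n ω) (fromℕ< j<n))

    P-⋃ : (∀ k l → k ≢ l → A k ⊥ A l) →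
          IsLub _≤_ (λ s → ∃[ n ] s ≈ ∑[ k < n ] P (A (toℕ k))) (P (⋃ ℕ A))
    P-⋃ A⊥ =
      (λ s (n , s≈∑) → ≤-respˡ-≈ (sym (trans s≈∑ (∑-P n))) (mean-mono-≤ (partialSum-≤ A⊥ n))) ,
      λ u u≥ → ≤-trans (mean-mono-≤ attains) (≤-respˡ-≈ (∑-P N) (u≥ _ (N , refl)))
      where
      bound : Bool → ℕ
      bound ω = proj₁ (partialSum-attains ω)
      -- With only two outcomes a single finite stage past both thresholds already reaches the
      -- supremum.
      N = bound false ℕ.+ bound true
      attains : ∀ ω → indicator (⋃ ℕ A) ω ≤ partialSum N ω
      attains false = proj₂ (partialSum-attains false) N (ℕ.m≤m+n _ _)
      attains true  = proj₂ (partialSum-attains true)  N (ℕ.m≤n+m _ _)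

  coin : ProbabilitySpace
  coin = record
    { Ω        = Bool
    ; Event    = λ _ → ⊤
    ; Event-U  = tt
    ; Event-∁  = λ _ → tt
    ; Event-⋃  = λ _ _ → tt
    ; Event-≐  = λ _ _ → tt
    ; P        = P
    ; P-≐      = λ A≐B _ → mean-cong (indicator-≐ A≐B)
    ; P-nonNeg = λ {A} _ → ≤-respˡ-≈ (mean-const 0#) (mean-mono-≤ (indicator-nonNeg A))
    ; P-U      = P-U
    ; P-⋃      = λ A _ → P-⋃ A
    }

  surely : ∀ {Q : Pred Bool 0ℓ} → (∀ ω → ω ∈ Q) → AlmostSurely coin Q
  surely Q = Univ , tt , (λ {ω} _ → Q ω) , P-U

  -- An empty event has mean indicator 0, which differs from 1. This turns an almost sure statement
  -- into one about an actual outcome.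
  almostSurely⇒inhabited : ∀ {Q : Pred Bool 0ℓ} → AlmostSurely coin Q → ∃[ ω ] ω ∈ Q
  almostSurely⇒inhabited (A , _ , A⊆Q , PA≈1) with em {∃[ ω ] ω ∈ A}
  ... | yes (ω , ω∈A) = ω , A⊆Q ω∈A
  ... | no  A≡∅       = contradiction
    (trans (sym PA≈1) (trans (mean-cong λ ω → indicator-∉ {A} λ ω∈A → A≡∅ (ω , ω∈A)) (mean-const 0#)))
    1≉0

  -- A function on two outcomes is itself simple, so the supremum of the lower sums is attained by
  -- splitting into the two atoms.
  mean-isLub : ∀ f → (∀ ω → 0# ≤ f ω) → IsLub _≤_ (LowerSum coin f) (mean f)
  mean-isLub f 0≤f = upper , λ u u≥ → u≥ (mean f) attained
    where
    upper : UpperBound _≤_ (LowerSum coin f) (mean f)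
    upper s (n , A , c , _ , A⊥ , _ , c≤f , s≈∑) =
      ≤-respˡ-≈ (sym (trans s≈∑ (∑-mean c (indicator ∘ A))))
        (mean-mono-≤ λ ω → disjoint-∑-≤ A c ω A⊥ (0≤f ω) (λ k → c≤f k ω))
    outcome : Fin 2 → Bool
    outcome zero    = false
    outcome (suc _) = true
    outcome-injective : ∀ k l → outcome k ≡ outcome l → k ≡ l
    outcome-injective zero       zero       _ = ≡.refl
    outcome-injective (suc zero) (suc zero) _ = ≡.refl
    outcomeEvent : Fin 2 → Pred Bool 0ℓ
    outcomeEvent k ω = outcome k ≡ ω
    decompose : ∀ ω → f ω ≈ ∑[ k < 2 ] (f (outcome k) * indicator (outcomeEvent k) ω)
    decompose false = sym (trans
      (+-cong (*-congˡ (indicator-∈ {outcomeEvent zero} ≡.refl))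
              (+-congʳ (*-congˡ (indicator-∉ {outcomeEvent (suc zero)} λ ()))))
      (solve 2 (λ x y → x :* 1ᵖ :+ (y :* con (+ 0) :+ con (+ 0)) := x) refl (f false) (f true)))
    decompose true  = sym (trans
      (+-cong (*-congˡ (indicator-∉ {outcomeEvent zero} λ ()))
              (+-congʳ (*-congˡ (indicator-∈ {outcomeEvent (suc zero)} ≡.refl))))
      (solve 2 (λ x y → x :* con (+ 0) :+ (y :* 1ᵖ :+ con (+ 0)) := y) refl (f false) (f true)))
    attained : LowerSum coin f (mean f)
    attained = 2 , outcomeEvent , f ∘ outcome , (λ _ → tt) ,
      (λ k l k≢l (k≡ω , l≡ω) → k≢l (outcome-injective k l (≡.trans k≡ω (≡.sym l≡ω)))) ,
      (λ k → 0≤f (outcome k)) ,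
      (λ { k ω ≡.refl → ≤-refl }) ,
      trans (mean-cong decompose) (sym (∑-mean (f ∘ outcome) (indicator ∘ outcomeEvent)))

  positivePart-negativePart : ∀ x → (x ⊔ 0#) - (- x ⊔ 0#) ≈ x
  positivePart-negativePart x = [ nonNeg , nonPos ]′ (total 0# x)
    where
    nonNeg : 0# ≤ x → (x ⊔ 0#) - (- x ⊔ 0#) ≈ x
    nonNeg 0≤x = trans
      (+-cong (Max.x≤y⇒y⊔x≈y totalOrder 0≤x) (-‿cong (Max.x≤y⇒x⊔y≈y totalOrder (0≤-⇒≤
        (≤-respʳ-≈ (solve 1 (λ x → x := con (+ 0) :- (:- x)) refl x) 0≤x)))))
      (solve 1 (λ x → x :- con (+ 0) := x) refl x)
    nonPos : x ≤ 0# → (x ⊔ 0#) - (- x ⊔ 0#) ≈ x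
    nonPos x≤0 = trans
      (+-cong (Max.x≤y⇒x⊔y≈y totalOrder x≤0) (-‿cong (Max.x≤y⇒y⊔x≈y totalOrder (neg-nonNeg x≤0))))
      (solve 1 (λ x → con (+ 0) :- (:- x) := x) refl x)

  expectation : ∀ f {v} → v ≈ mean f → Expectation coin f v
  expectation f {v} v≈ = (λ _ → tt) , mean f⁺ , mean f⁻ ,
    mean-isLub f⁺ (λ ω → Max.x≤y⊔x totalOrder (f ω) 0#) ,
    mean-isLub f⁻ (λ ω → Max.x≤y⊔x totalOrder (- f ω) 0#) ,
    trans v≈ (trans (mean-cong (λ ω → sym (positivePart-negativePart (f ω))))
      (solve 5 (λ h a b c d → h :* ((a :- b) :+ (c :- d)) := h :* (a :+ c) :- h :* (b :+ d))
        refl ½ (f⁺ false) (f⁻ false) (f⁺ true) (f⁻ true)))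
    where
    f⁺ f⁻ : Bool → Carrier
    f⁺ ω = f ω ⊔ 0#
    f⁻ ω = (- f ω) ⊔ 0#

  sign : Bool → Carrier
  sign false = 1#
  sign true  = - 1#

  sign² : ∀ ω → sign ω * sign ω ≈ 1#
  sign² false = *-identityˡ 1#
  sign² true  = solve 0 (:- 1ᵖ :* :- 1ᵖ := 1ᵖ) refl

  -- The reason why expressions quadratic in the signed pair lose their randomness.
  sign-cancel : ∀ ω x → sign ω * (sign ω * x) ≈ x
  sign-cancel ω x = trans (sym (*-assoc _ _ _)) (trans (*-congʳ (sign² ω)) (*-identityˡ x))

  expectation-odd : ∀ x → Expectation coin (λ ω → sign ω * x) 0#
  expectation-odd x = expectation _
    (solve 2 (λ h x → con (+ 0) := h :* (1ᵖ :* x :+ :- 1ᵖ :* x)) refl ½ x)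

  expectation-even : ∀ {f x} → (∀ ω → f ω ≈ x) → Expectation coin f x
  expectation-even {f} {x} f≈x = expectation f (sym (trans (mean-cong f≈x) (mean-const x)))

-- Identities and the supply inequality on one coordinate pair.

module BlockProperties (ℝ : Reals) where
  open Reals ℝ hiding (zero)
  open OrderedField ℝ
  open LinearAlgebra ℝ
  open MatrixProperties ℝ
  open PairProperties ℝ
  open import Relation.Binary.Reasoning.Setoid setoid

  pairSupported-*ᵥ : ∀ {m} (J : Matrix (m ℕ.* 2) m) → PairSupported {m} J → (x : Vector Carrier m) →
                     ∀ i a → pair (J *ᵥ x) i a ≈ x i * column J i a
  pairSupported-*ᵥ J J-supp x i a = trans
    (∑-supported i (λ k → J (combine i a) k * x k) λ k k≢i →
      trans (*-congʳ (J-supp k i a (k≢i ∘ ≡.sym))) (zeroˡ (x k)))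
    (*-comm _ _)

  pairSupported-ᵀ-*ᵥ : ∀ {m} (N : Matrix (m ℕ.* 2) m) → PairSupported {m} N →
                       (y : Vector Carrier (m ℕ.* 2)) →
                       ∀ i → (N ᵀ *ᵥ y) i ≈ ⟨ column N i , pair y i ⟩
  pairSupported-ᵀ-*ᵥ {m} N N-supp y i = trans (⟨⟩-pairs {m} ((N ᵀ) i) y)
    (∑-supported i (λ k → ⟨ pair ((N ᵀ) i) k , pair y k ⟩) λ k k≢i →
      ∑-zero λ a → trans (*-congʳ (N-supp i k a k≢i)) (zeroˡ (pair y k a)))

  module _ {n} (W W⁻¹ D : Matrix n n) (W-sym : Symmetric W) (W⁻¹W≋I : W⁻¹ · W ≋ I) where

    -- As `W` is symmetric, W(W⁻¹)* is the transpose of W⁻¹W. This translates hypotheses stated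
    -- through `D` into the language of `B`.
    W·Bᵀ≋D : W · (D ᵀ · W⁻¹) ᵀ ≋ D
    W·Bᵀ≋D i j = begin
      (W · B ᵀ) i j               ≈⟨ ᵀ-· B (W ᵀ) i j ⟨
      (B · W ᵀ) j i               ≈⟨ ·-congˡ B W-sym j i ⟩
      (B · W) j i                 ≈⟨ ·-assoc (D ᵀ) W⁻¹ W j i ⟩
      (D ᵀ · (W⁻¹ · W)) j i       ≈⟨ ·-congˡ (D ᵀ) W⁻¹W≋I j i ⟩
      (D ᵀ · I) j i               ≈⟨ ·-identityʳ (D ᵀ) j i ⟩
      D i j                       ∎
      where B = D ᵀ · W⁻¹

    -- The form of `U` at v thereby becomes ⟨Bv , Wv⟩ = ⟨Bv , y⟩, into which the response equation
    -- can be substituted.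
    U≋Bᵀ·W : W⁻¹ · D · W ≋ (D ᵀ · W⁻¹) ᵀ · W
    U≋Bᵀ·W = ·-congʳ W λ i j → begin
      (W⁻¹ · D) i j               ≈⟨ ·-congˡ W⁻¹ W·Bᵀ≋D i j ⟨
      (W⁻¹ · (W · B ᵀ)) i j       ≈⟨ ·-assoc W⁻¹ W (B ᵀ) i j ⟨
      (W⁻¹ · W · B ᵀ) i j         ≈⟨ ·-congʳ (B ᵀ) W⁻¹W≋I i j ⟩
      (I · B ᵀ) i j               ≈⟨ ·-identityˡ (B ᵀ) i j ⟩
      (B ᵀ) i j                   ∎
      where B = D ᵀ · W⁻¹

    tr-WᵀEW : (E : Matrix n n) → tr (W ᵀ · E · W) ≈ tr (E · (W · W))
    tr-WᵀEW E = begin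
      tr (W ᵀ · E · W)      ≈⟨ tr-comm (W ᵀ · E) W ⟩
      tr (W · (W ᵀ · E))    ≈⟨ tr-cong (·-assoc W (W ᵀ) E) ⟨
      tr (W · W ᵀ · E)      ≈⟨ tr-comm (W · W ᵀ) E ⟩
      tr (E · (W · W ᵀ))    ≈⟨ tr-cong (·-congˡ E (·-congˡ W W-sym)) ⟩
      tr (E · (W · W))      ∎

    -- Cyclicity of the trace brings `W` next to B*, and their product is `D`. So the trace
    -- hypothesis bounds the blocks of `Φ`.
    tr-BᵀTW : (T : Matrix n n) → tr ((D ᵀ · W⁻¹) ᵀ · T · W) ≈ tr (D · T)
    tr-BᵀTW T = begin
      tr (B ᵀ · T · W)      ≈⟨ tr-comm (B ᵀ · T) W ⟩
      tr (W · (B ᵀ · T))    ≈⟨ tr-cong (·-assoc W (B ᵀ) T) ⟨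
      tr (W · B ᵀ · T)      ≈⟨ tr-cong (·-congʳ T W·Bᵀ≋D) ⟩
      tr (D · T)            ∎
      where B = D ᵀ · W⁻¹

  module _ (B W U R : Matrix 2 2) (U≋BᵀW : U ≋ B ᵀ · W) (j n : Vector Carrier 2)
           (K h : Carrier) (0<K : 0# < K) where

    private
      d : Vector Carrier 2
      d a = (B ᵀ *ᵥ j) a + (W ᵀ *ᵥ n) a
      κ χ : Carrier
      κ = (4# * K) ⁻¹
      χ = h + tr R

    ⟨d,v⟩ : ∀ v → ⟨ d , v ⟩ ≈ ⟨ B *ᵥ v , j ⟩ + ⟨ n , W *ᵥ v ⟩
    ⟨d,v⟩ v = trans (⟨⟩-+ˡ (B ᵀ *ᵥ j) (W ᵀ *ᵥ n) v)
      (+-cong (trans (⟨⟩-comm (B ᵀ *ᵥ j) v) (ᵀ-*ᵥ-adjoint B v j))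
              (trans (⟨⟩-comm (W ᵀ *ᵥ n) v) (trans (ᵀ-*ᵥ-adjoint W v n) (⟨⟩-comm (W *ᵥ v) n))))

    adj-form : ∀ v → ⟨ v , adj R *ᵥ v ⟩ ≈ tr R * ⟨ v , v ⟩ - ⟨ v , R *ᵥ v ⟩
    adj-form v = trans (form-⊖ (tr R ∙ I) R v)
      (+-congʳ (trans (form-∙ (tr R) I v) (*-congˡ (form-I v))))

    slack-form : ∀ v → ⟨ v , (Sym U ⊖ (h ∙ I) ⊖ adj R ⊖ (κ ∙ outer d d)) *ᵥ v ⟩ ≈
      ⟨ B *ᵥ v , W *ᵥ v ⟩ - χ * ⟨ v , v ⟩ + ⟨ v , R *ᵥ v ⟩ - κ * (⟨ d , v ⟩ * ⟨ d , v ⟩)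
    slack-form v = begin
      ⟨ v , (Sym U ⊖ (h ∙ I) ⊖ adj R ⊖ (κ ∙ outer d d)) *ᵥ v ⟩
        ≈⟨ form-⊖ (Sym U ⊖ (h ∙ I) ⊖ adj R) (κ ∙ outer d d) v ⟩
      ⟨ v , (Sym U ⊖ (h ∙ I) ⊖ adj R) *ᵥ v ⟩ - ⟨ v , (κ ∙ outer d d) *ᵥ v ⟩
        ≈⟨ +-congʳ (trans (form-⊖ (Sym U ⊖ (h ∙ I)) (adj R) v) (+-congʳ (form-⊖ (Sym U) (h ∙ I) v))) ⟩
      ⟨ v , Sym U *ᵥ v ⟩ - ⟨ v , (h ∙ I) *ᵥ v ⟩ - ⟨ v , adj R *ᵥ v ⟩ - ⟨ v , (κ ∙ outer d d) *ᵥ v ⟩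
        ≈⟨ +-cong (+-cong (+-cong U-form (-‿cong hI-form)) (-‿cong (adj-form v))) (-‿cong d-form) ⟩
      ⟨ B *ᵥ v , W *ᵥ v ⟩ - h * ⟨ v , v ⟩ - (tr R * ⟨ v , v ⟩ - ⟨ v , R *ᵥ v ⟩)
        - κ * (⟨ d , v ⟩ * ⟨ d , v ⟩)
        ≈⟨ solve 6 (λ b h q t r k →
             b :- h :* q :- (t :* q :- r) :- k := b :- (h :+ t) :* q :+ r :- k)
             refl _ h ⟨ v , v ⟩ (tr R) _ _ ⟩
      ⟨ B *ᵥ v , W *ᵥ v ⟩ - χ * ⟨ v , v ⟩ + ⟨ v , R *ᵥ v ⟩ - κ * (⟨ d , v ⟩ * ⟨ d , v ⟩) ∎
      where
      U-form = trans (Sym-form U v)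
        (trans (⟨⟩-congˡ v (*ᵥ-congˡ v U≋BᵀW)) (form-ᵀ· B W v))
      hI-form = trans (form-∙ h I v) (*-congˡ (form-I v))
      d-form = trans (form-∙ κ (outer d d) v) (*-congˡ (form-outer d d v))

    -- The slack at v plus the completed square K x² − (d·v) x + (d·v)²/4K.
    supply-≤ : PosSemidef (Sym U ⊖ (h ∙ I) ⊖ adj R ⊖ (κ ∙ outer d d)) →
      ∀ v y t x → (∀ a → y a ≈ (W *ᵥ v) a) → (∀ a → y a ≈ t a + x * j a) →
      x * ⟨ n , y ⟩ ≤ ⟨ B *ᵥ v , t ⟩ + ⟨ v , R *ᵥ v ⟩ - χ * ⟨ v , v ⟩ + K * (x * x)
    supply-≤ (_ , slack≥0) v y t x y≈Wv y≈t+xj = ≤-byDifference _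
      (+-nonNeg (≤-respʳ-≈ (slack-form v) (slack≥0 v)) (completeSquare 0<K (- ⟨ d , v ⟩) x))
      (begin
        ⟨ B *ᵥ v , t ⟩ + r - χ * q + K * (x * x) - x * ⟨ n , y ⟩
          ≈⟨ solve 8 (λ bt r χq Kx² x ny bj κ →
               bt :+ r :- χq :+ Kx² :- x :* ny :=
               (bt :+ x :* bj :- χq :+ r :- κ :* ((bj :+ ny) :* (bj :+ ny))) :+
               (Kx² :+ (:- (bj :+ ny)) :* x :+ κ :* ((:- (bj :+ ny)) :* (:- (bj :+ ny)))))
               refl ⟨ B *ᵥ v , t ⟩ r (χ * q) (K * (x * x)) x ⟨ n , y ⟩ ⟨ B *ᵥ v , j ⟩ κ ⟩
        (⟨ B *ᵥ v , t ⟩ + x * ⟨ B *ᵥ v , j ⟩ - χ * q + r - κ * (δ′ * δ′)) +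
        (K * (x * x) + (- δ′) * x + κ * ((- δ′) * (- δ′)))
          ≈⟨ +-cong (+-cong (+-congʳ (+-congʳ BW)) (-‿cong (*-congˡ (*-cong δ≈ δ≈))))
                    (+-cong (+-congˡ (*-congʳ (-‿cong δ≈))) (*-congˡ (*-cong (-‿cong δ≈) (-‿cong δ≈)))) ⟩
        (⟨ B *ᵥ v , W *ᵥ v ⟩ - χ * q + r - κ * (⟨ d , v ⟩ * ⟨ d , v ⟩)) +
        (K * (x * x) + (- ⟨ d , v ⟩) * x + κ * ((- ⟨ d , v ⟩) * (- ⟨ d , v ⟩))) ∎)
      where
      q = ⟨ v , v ⟩
      r = ⟨ v , R *ᵥ v ⟩
      δ′ = ⟨ B *ᵥ v , j ⟩ + ⟨ n , y ⟩
      δ≈ : δ′ ≈ ⟨ d , v ⟩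
      δ≈ = trans (+-congˡ (⟨⟩-congˡ n y≈Wv)) (sym (⟨d,v⟩ v))
      -- Exactness enters here: Wv = y = t + xj. The term x⟨Bv , j⟩ that it produces cancels the
      -- part of x⟨d , v⟩ coming from `j` and leaves x⟨n , y⟩.
      BW : ⟨ B *ᵥ v , t ⟩ + x * ⟨ B *ᵥ v , j ⟩ ≈ ⟨ B *ᵥ v , W *ᵥ v ⟩
      BW = begin
        ⟨ B *ᵥ v , t ⟩ + x * ⟨ B *ᵥ v , j ⟩          ≈⟨ +-congˡ (⟨⟩-*ʳ x (B *ᵥ v) j) ⟨
        ⟨ B *ᵥ v , t ⟩ + ⟨ B *ᵥ v , (λ a → x * j a) ⟩ ≈⟨ ⟨⟩-+ʳ (B *ᵥ v) t (λ a → x * j a) ⟨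
        ⟨ B *ᵥ v , (λ a → t a + x * j a) ⟩
          ≈⟨ ⟨⟩-congˡ (B *ᵥ v) (λ a → trans (sym (y≈t+xj a)) (y≈Wv a)) ⟩
        ⟨ B *ᵥ v , W *ᵥ v ⟩                          ∎

-- The form `Φ` along exact responses.

module Response (em : ExcludedMiddle 0ℓ) (ℝ : Reals) where
  open Reals ℝ hiding (zero)
  open LinearAlgebra ℝ
  open OrderedField ℝ
  open MatrixProperties ℝ
  open PairProperties ℝ
  open BlockProperties ℝ
  open TraceBound em ℝ
  open import Relation.Binary.Reasoning.Setoid setoid

  module Certificate
    {m : ℕ} (T E : Matrix (m ℕ.* 2) (m ℕ.* 2)) (J N : Matrix (m ℕ.* 2) m)
    (C : Fin m → Carrier)
    (A⁻¹ : Matrix (m ℕ.* 2) (m ℕ.* 2)) (A·A⁻¹≋I : (I ⊖ T) · A⁻¹ ≋ I)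
    (JᵀJ≋I : J ᵀ · J ≋ I)
    (0<C : ∀ i → 0# < C i)
    (E⪰TᵀCT : E ⪰ T ᵀ · directSum (λ i → C i ∙ I) · T)
    (J-supp : PairSupported {m} J) (N-supp : PairSupported {m} N)
    (W W⁻¹ D : Fin m → Matrix 2 2) (K h : Fin m → Carrier)
    (W-posDef : ∀ i → PosDef (W i))
    (W-inverse : ∀ i → IsInverse (W i) (W⁻¹ i))
    (0<K : ∀ i → 0# < K i)
    where

    B U R : Fin m → Matrix 2 2
    B i = (D i) ᵀ · W⁻¹ i
    U i = W⁻¹ i · D i · W i
    R i = (4# * C i) ⁻¹ ∙ ((B i) ᵀ · B i)

    d : Fin m → Vector Carrier 2
    d i a = ((B i) ᵀ *ᵥ column J i) a + ((W i) ᵀ *ᵥ column N i) a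

    χ : Fin m → Carrier
    χ i = h i + tr (R i)

    𝐖 𝐖⁻¹ 𝐁 : Matrix (m ℕ.* 2) (m ℕ.* 2)
    𝐖   = directSum W
    𝐖⁻¹ = directSum W⁻¹
    𝐁   = directSum B

    -- Since E ⪰ T*CT, Φ(v) dominates the square |√C T𝐖v + 𝐁v∕(2√C)|².
    Φ : Matrix (m ℕ.* 2) (m ℕ.* 2)
    Φ = 𝐖 ᵀ · E · 𝐖 ⊕ 𝐁 ᵀ · T · 𝐖 ⊕ directSum R

    Φ-form : ∀ v → ⟨ v , Φ *ᵥ v ⟩ ≈
      ⟨ 𝐖 *ᵥ v , E *ᵥ 𝐖 *ᵥ v ⟩ + ⟨ 𝐁 *ᵥ v , T *ᵥ 𝐖 *ᵥ v ⟩ + ⟨ v , directSum R *ᵥ v ⟩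
    Φ-form v = trans (form-⊕ (𝐖 ᵀ · E · 𝐖 ⊕ 𝐁 ᵀ · T · 𝐖) (directSum R) v)
      (+-congʳ (trans (form-⊕ (𝐖 ᵀ · E · 𝐖) (𝐁 ᵀ · T · 𝐖) v)
        (+-cong (form-ᵀ·· 𝐖 E 𝐖 v) (form-ᵀ·· 𝐁 T 𝐖 v))))

    R-form : ∀ i x → ⟨ x , R i *ᵥ x ⟩ ≈ (4# * C i) ⁻¹ * ⟨ B i *ᵥ x , B i *ᵥ x ⟩
    R-form i x = trans (form-∙ _ (B i ᵀ · B i) x) (*-congˡ (form-ᵀ· (B i) (B i) x))

    C-form : ∀ t → ⟨ t , directSum (λ i → C i ∙ I) *ᵥ t ⟩ ≈
                   ∑[ i < m ] (C i * ⟨ pair t i , pair t i ⟩)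
    C-form t = trans (directSum-form (λ i → C i ∙ I) t)
      (sum-cong-≋ λ i → trans (form-∙ (C i) I (pair t i)) (*-congˡ (form-I (pair t i))))

    completeSquare-⟨⟩ : ∀ {n c} → 0# < c → (b t : Vector Carrier n) →
      0# ≤ c * ⟨ t , t ⟩ + ⟨ b , t ⟩ + (4# * c) ⁻¹ * ⟨ b , b ⟩
    completeSquare-⟨⟩ {c = c} 0<c b t = ≤-respʳ-≈
      (trans (∑-distrib-+ (λ k → c * (t k * t k) + b k * t k) (λ k → (4# * c) ⁻¹ * (b k * b k)))
        (+-cong
          (trans (∑-distrib-+ (λ k → c * (t k * t k)) (λ k → b k * t k))
            (+-congʳ (sym (*-distribˡ-sum c (λ k → t k * t k)))))
          (sym (*-distribˡ-sum ((4# * c) ⁻¹) (λ k → b k * b k)))))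
      (∑-nonNeg λ k → completeSquare 0<c (b k) (t k))

    -- With t = T𝐖v and b = 𝐁v, the bound on `E` provides Cᵢ|tᵢ|² on each pair; the cross term is
    -- ⟨bᵢ , tᵢ⟩ and Rᵢ contributes |bᵢ|²/4Cᵢ, which together are a completed square.
    Φ-positive : PositiveForm Φ
    Φ-positive v = ≤-respʳ-≈ eq (+-nonNeg E-slack squares)
      where
      w t b : Vector Carrier (m ℕ.* 2)
      w = 𝐖 *ᵥ v
      t = T *ᵥ w
      b = 𝐁 *ᵥ v
      𝐂 = directSum (λ i → C i ∙ I)
      E-slack : 0# ≤ ⟨ w , E *ᵥ w ⟩ - ⟨ t , 𝐂 *ᵥ t ⟩
      E-slack = ≤-respʳ-≈ (trans (form-⊖ E (T ᵀ · 𝐂 · T) w) (+-congˡ (-‿cong (form-ᵀ·· T 𝐂 T w))))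
        (proj₂ E⪰TᵀCT w)
      term : Fin m → Carrier
      term i = C i * ⟨ pair t i , pair t i ⟩ + ⟨ pair b i , pair t i ⟩ +
               (4# * C i) ⁻¹ * ⟨ pair b i , pair b i ⟩
      squares : 0# ≤ sum term
      squares = ∑-nonNeg λ i → completeSquare-⟨⟩ (0<C i) (pair b i) (pair t i)
      R≈ : ∀ i → (4# * C i) ⁻¹ * ⟨ pair b i , pair b i ⟩ ≈ ⟨ pair v i , R i *ᵥ pair v i ⟩
      R≈ i = sym (trans (R-form i (pair v i))
        (*-congˡ (⟨⟩-cong (λ a → sym (directSum-*ᵥ B v i a)) (λ a → sym (directSum-*ᵥ B v i a)))))
      sum-term : sum term ≈ ⟨ t , 𝐂 *ᵥ t ⟩ + ⟨ b , t ⟩ + ⟨ v , directSum R *ᵥ v ⟩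
      sum-term = trans
        (∑-distrib-+ (λ i → C i * ⟨ pair t i , pair t i ⟩ + ⟨ pair b i , pair t i ⟩)
                     (λ i → (4# * C i) ⁻¹ * ⟨ pair b i , pair b i ⟩))
        (+-cong
          (trans (∑-distrib-+ (λ i → C i * ⟨ pair t i , pair t i ⟩) (λ i → ⟨ pair b i , pair t i ⟩))
                 (+-cong (sym (C-form t)) (sym (⟨⟩-pairs {m} b t))))
          (trans (sum-cong-≋ R≈) (sym (directSum-form R v))))
      eq : ⟨ w , E *ᵥ w ⟩ - ⟨ t , 𝐂 *ᵥ t ⟩ + sum term ≈ ⟨ v , Φ *ᵥ v ⟩
      eq = trans (+-congˡ sum-term) (trans
        (solve 4 (λ e c b r → (e :- c) :+ ((c :+ b) :+ r) := (e :+ b) :+ r) refl _ _ _ _)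
        (sym (Φ-form v)))

    W-symmetric : ∀ i → Symmetric (W i)
    W-symmetric i = proj₁ (W-posDef i)

    tr-block-Φ : ∀ i → tr (block Φ i) ≈
      tr (block E i · (W i · W i)) + tr (D i · block T i) + tr (R i)
    tr-block-Φ i = begin
      tr (block Φ i)
        ≈⟨ tr-⊕ (block (𝐖 ᵀ · E · 𝐖 ⊕ 𝐁 ᵀ · T · 𝐖) i) (block (directSum R) i) ⟩
      tr (block (𝐖 ᵀ · E · 𝐖 ⊕ 𝐁 ᵀ · T · 𝐖) i) + tr (block (directSum R) i)
        ≈⟨ +-congʳ (tr-⊕ (block (𝐖 ᵀ · E · 𝐖) i) (block (𝐁 ᵀ · T · 𝐖) i)) ⟩
      tr (block (𝐖 ᵀ · E · 𝐖) i) + tr (block (𝐁 ᵀ · T · 𝐖) i) + tr (block (directSum R) i)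
        ≈⟨ +-cong (+-cong (tr-cong (block-directSum-conjugate W W E i))
                          (tr-cong (block-directSum-conjugate B W T i)))
                  (tr-cong (block-directSum R i)) ⟩
      tr (W i ᵀ · block E i · W i) + tr (B i ᵀ · block T i · W i) + tr (R i)
        ≈⟨ +-congʳ (+-cong (tr-WᵀEW (W i) (W⁻¹ i) (D i) (W-symmetric i) (proj₂ (W-inverse i)) (block E i))
                           (tr-BᵀTW (W i) (W⁻¹ i) (D i) (W-symmetric i) (proj₂ (W-inverse i)) (block T i))) ⟩
      tr (block E i · (W i · W i)) + tr (D i · block T i) + tr (R i) ∎

    response : Vector Carrier m → Vector Carrier (m ℕ.* 2)
    response ξ = A⁻¹ *ᵥ J *ᵥ ξ

    -- The linear map ξ ↦ W⁻¹y from inputs to rescaled responses. Its m columns span the subspace on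
    -- which `Φ` has to be compared with the norm.
    G : Matrix (m ℕ.* 2) m
    G = 𝐖⁻¹ · A⁻¹ · J

    G-*ᵥ : ∀ ξ p → (G *ᵥ ξ) p ≈ (𝐖⁻¹ *ᵥ response ξ) p
    G-*ᵥ ξ p = trans (*ᵥ-· (𝐖⁻¹ · A⁻¹) J ξ p) (*ᵥ-· 𝐖⁻¹ A⁻¹ (J *ᵥ ξ) p)

    response-exact : ∀ ξ p → ((I ⊖ T) *ᵥ response ξ) p ≈ (J *ᵥ ξ) p
    response-exact ξ p = trans (sym (*ᵥ-· (I ⊖ T) A⁻¹ (J *ᵥ ξ) p))
      (trans (*ᵥ-congˡ (J *ᵥ ξ) A·A⁻¹≋I p) (I-*ᵥ (J *ᵥ ξ) p))

    response-pair : ∀ ξ i a → pair (response ξ) i a ≈ pair (T *ᵥ response ξ) i a + ξ i * column J i a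
    response-pair ξ i a = begin
      y p                                 ≈⟨ solve 2 (λ y t → y := t :+ (y :- t)) refl (y p) ((T *ᵥ y) p) ⟩
      (T *ᵥ y) p + (y p - (T *ᵥ y) p)     ≈⟨ +-congˡ (+-congʳ (I-*ᵥ y p)) ⟨
      (T *ᵥ y) p + ((I *ᵥ y) p - (T *ᵥ y) p) ≈⟨ +-congˡ (⟨⟩--ˡ (I p) (T p) y) ⟨
      (T *ᵥ y) p + ((I ⊖ T) *ᵥ y) p       ≈⟨ +-congˡ (response-exact ξ p) ⟩
      (T *ᵥ y) p + (J *ᵥ ξ) p             ≈⟨ +-congˡ (pairSupported-*ᵥ J J-supp ξ i a) ⟩
      (T *ᵥ y) p + ξ i * column J i a     ∎
      where
      y = response ξ
      p = combine i a

    -- The input is recovered from the response as ξ = J*Jξ = J*(I - T)y.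
    response≈0⇒≈0 : ∀ ξ → (∀ p → response ξ p ≈ 0#) → ∀ i → ξ i ≈ 0#
    response≈0⇒≈0 ξ y≈0 i = begin
      ξ i                  ≈⟨ I-*ᵥ ξ i ⟨
      (I *ᵥ ξ) i           ≈⟨ *ᵥ-congˡ ξ JᵀJ≋I i ⟨
      ((J ᵀ · J) *ᵥ ξ) i     ≈⟨ *ᵥ-· (J ᵀ) J ξ i ⟩
      (J ᵀ *ᵥ J *ᵥ ξ) i    ≈⟨ *ᵥ-zero (J ᵀ) (λ p → trans (sym (response-exact ξ p)) (*ᵥ-zero (I ⊖ T) y≈0 p)) i ⟩
      0#                   ∎

    pair-𝐖𝐖⁻¹ : ∀ y i a → (W i *ᵥ pair (𝐖⁻¹ *ᵥ y) i) a ≈ pair y i a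
    pair-𝐖𝐖⁻¹ y i a = begin
      (W i *ᵥ pair (𝐖⁻¹ *ᵥ y) i) a       ≈⟨ *ᵥ-congʳ (W i) (directSum-*ᵥ W⁻¹ y i) a ⟩
      (W i *ᵥ W⁻¹ i *ᵥ pair y i) a       ≈⟨ *ᵥ-· (W i) (W⁻¹ i) (pair y i) a ⟨
      ((W i · W⁻¹ i) *ᵥ pair y i) a        ≈⟨ *ᵥ-congˡ (pair y i) (proj₁ (W-inverse i)) a ⟩
      (I *ᵥ pair y i) a                  ≈⟨ I-*ᵥ (pair y i) a ⟩
      pair y i a                         ∎

    W-*ᵥ-G : ∀ ξ i a → (W i *ᵥ pair (G *ᵥ ξ) i) a ≈ pair (response ξ) i a
    W-*ᵥ-G ξ i a = trans (*ᵥ-congʳ (W i) (λ b → G-*ᵥ ξ (combine i b)) a) (pair-𝐖𝐖⁻¹ (response ξ) i a)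

    𝐖-*ᵥ-G : ∀ ξ p → (𝐖 *ᵥ G *ᵥ ξ) p ≈ response ξ p
    𝐖-*ᵥ-G ξ = ≈-byPairs λ i a → trans (directSum-*ᵥ W (G *ᵥ ξ) i a) (W-*ᵥ-G ξ i a)

    G-injective : Injective G
    G-injective ξ Gξ≈0 = response≈0⇒≈0 ξ λ p → trans (sym (𝐖-*ᵥ-G ξ p)) (*ᵥ-zero 𝐖 Gξ≈0 p)

    module Bound
      (tr≤h : ∀ i → tr (block E i · (W i · W i)) + tr (D i · block T i) ≤ h i)
      (0<χ : ∀ i → 0# < χ i)
      (slack : ∀ i → PosSemidef (Sym (U i) ⊖ (h i ∙ I) ⊖ adj (R i)
                                   ⊖ ((4# * K i) ⁻¹ ∙ outer (d i) (d i))))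
      where

      weight weight⁻¹ : Vector Carrier (m ℕ.* 2)
      weight p   = χ (quotient {m} 2 p)
      weight⁻¹ p = χ (quotient {m} 2 p) ⁻¹

      quotient-combine : ∀ i (a : Fin 2) → quotient {m} 2 (combine i a) ≡.≡ i
      quotient-combine i a = ≡.cong proj₁ (remQuot-combine {m} i a)

      tr-Φ≤χ : ∀ i → tr (block Φ i) ≤ χ i
      tr-Φ≤χ i = ≤-respˡ-≈ (sym (tr-block-Φ i)) (+-monoˡ-≤ (tr (R i)) (tr≤h i))

      -- Both coordinates of pair i carry the weight χᵢ, so the pair contributes tr Φᵢᵢ/χᵢ, which is
      -- at most 1; there are m pairs.
      weightedTr-Φ : ∑[ p < m ℕ.* 2 ] (weight⁻¹ p * Φ p p) ≤ ∑[ _ < m ] 1#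
      weightedTr-Φ = ≤-respˡ-≈ (sym (∑-pairs {m} (λ p → weight⁻¹ p * Φ p p)))
        (∑-mono-≤ λ i → ≤-respˡ-≈
          (trans (*-distribˡ-sum (χ i ⁻¹) (λ a → block Φ i a a))
            (sum-cong-≋ λ a → *-congʳ {block Φ i a a} (reflexive (≡.cong (λ k → χ k ⁻¹) (≡.sym (quotient-combine i a))))))
          (≤-respʳ-≈ (trans (*-comm _ _) (*-inverseʳ (<⇒≉0 (0<χ i))))
            (*-monoˡ-≤-nonNeg (⁻¹-nonNeg (0<χ i)) (tr-Φ≤χ i))))

      weight-normSq : ∀ v → ∑[ p < m ℕ.* 2 ] (weight p * (v p * v p)) ≈
                            ∑[ i < m ] (χ i * ⟨ pair v i , pair v i ⟩)
      weight-normSq v = trans (∑-pairs {m} (λ p → weight p * (v p * v p)))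
        (sum-cong-≋ λ i → trans
          (sum-cong-≋ λ a → *-congʳ {pair v i a * pair v i a} (reflexive (≡.cong χ (quotient-combine i a))))
          (sym (*-distribˡ-sum (χ i) (λ a → pair v i a * pair v i a))))

      -- Adding up `supply-≤` bounds ξ*N*y by the 𝐁 and R parts of `Φ`, minus the norm, plus Σ
      -- Kᵢξᵢ². The term y*Ey supplies the missing part of `Φ`, and once the Kᵢ terms cancel the
      -- remaining gap is the hypothesis on `Φ`.
      cost-≤ : ∀ ξ →
        ⟨ G *ᵥ ξ , Φ *ᵥ G *ᵥ ξ ⟩ ≤ ∑[ i < m ] (χ i * ⟨ pair (G *ᵥ ξ) i , pair (G *ᵥ ξ) i ⟩) →
        ⟨ response ξ , E *ᵥ response ξ ⟩ + ⟨ ξ , N ᵀ *ᵥ response ξ ⟩ ≤ ∑[ i < m ] (K i * (ξ i * ξ i))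
      cost-≤ ξ bound = ≤-trans (+-monoʳ-≤ _ (∑-mono-≤ supply))
          (≤-byDifference _ (≤⇒0≤- bound) (begin
            k - (e + ∑[ i < m ] (bt i + vr i - χq i + Kξ² i))
              ≈⟨ +-congˡ (-‿cong (+-congˡ sum-split)) ⟩
            k - (e + (⟨ 𝐁 *ᵥ v , T *ᵥ y ⟩ + ⟨ v , directSum R *ᵥ v ⟩ - sum χq + k))
              ≈⟨ solve 5 (λ k e b r χ → k :- (e :+ (b :+ r :- χ :+ k)) := χ :- (e :+ b :+ r))
                   refl k e ⟨ 𝐁 *ᵥ v , T *ᵥ y ⟩ ⟨ v , directSum R *ᵥ v ⟩ (sum χq) ⟩
            sum χq - (e + ⟨ 𝐁 *ᵥ v , T *ᵥ y ⟩ + ⟨ v , directSum R *ᵥ v ⟩)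
              ≈⟨ +-congˡ (-‿cong (+-congʳ (+-cong
                   (⟨⟩-cong (𝐖-*ᵥ-G ξ) (*ᵥ-congʳ E (𝐖-*ᵥ-G ξ)))
                   (⟨⟩-congˡ (𝐁 *ᵥ v) (*ᵥ-congʳ T (𝐖-*ᵥ-G ξ)))))) ⟨
            sum χq - (⟨ 𝐖 *ᵥ v , E *ᵥ 𝐖 *ᵥ v ⟩ + ⟨ 𝐁 *ᵥ v , T *ᵥ 𝐖 *ᵥ v ⟩ + ⟨ v , directSum R *ᵥ v ⟩)
              ≈⟨ +-congˡ (-‿cong (Φ-form v)) ⟨
            sum χq - ⟨ v , Φ *ᵥ v ⟩ ∎))
        where
        y v : Vector Carrier (m ℕ.* 2)
        y = response ξ
        v = G *ᵥ ξ
        k e : Carrier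
        k = ∑[ i < m ] (K i * (ξ i * ξ i))
        e = ⟨ y , E *ᵥ y ⟩
        bt vr χq Kξ² : Fin m → Carrier
        bt i  = ⟨ B i *ᵥ pair v i , pair (T *ᵥ y) i ⟩
        vr i  = ⟨ pair v i , R i *ᵥ pair v i ⟩
        χq i  = χ i * ⟨ pair v i , pair v i ⟩
        Kξ² i = K i * (ξ i * ξ i)
        supply : ∀ i → ξ i * (N ᵀ *ᵥ y) i ≤ bt i + vr i - χq i + Kξ² i
        supply i = ≤-respˡ-≈ (*-congˡ (sym (pairSupported-ᵀ-*ᵥ N N-supp y i)))
          (supply-≤ (B i) (W i) (U i) (R i)
            (U≋Bᵀ·W (W i) (W⁻¹ i) (D i) (W-symmetric i) (proj₂ (W-inverse i)))
            (column J i) (column N i) (K i) (h i) (0<K i) (slack i)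
            (pair v i) (pair y i) (pair (T *ᵥ y) i) (ξ i)
            (λ a → sym (W-*ᵥ-G ξ i a)) (response-pair ξ i))
        sum-bt : sum bt ≈ ⟨ 𝐁 *ᵥ v , T *ᵥ y ⟩
        sum-bt = sym (trans (⟨⟩-pairs {m} (𝐁 *ᵥ v) (T *ᵥ y))
          (sum-cong-≋ λ i → ⟨⟩-congʳ (pair (T *ᵥ y) i) (directSum-*ᵥ B v i)))
        sum-split : ∑[ i < m ] (bt i + vr i - χq i + Kξ² i) ≈
                    ⟨ 𝐁 *ᵥ v , T *ᵥ y ⟩ + ⟨ v , directSum R *ᵥ v ⟩ - sum χq + k
        sum-split = begin
          ∑[ i < m ] (bt i + vr i - χq i + Kξ² i)
            ≈⟨ ∑-distrib-+ (λ i → bt i + vr i - χq i) Kξ² ⟩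
          ∑[ i < m ] (bt i + vr i - χq i) + k
            ≈⟨ +-congʳ (trans (∑-distrib-- (λ i → bt i + vr i) χq) (+-congʳ (∑-distrib-+ bt vr))) ⟩
          sum bt + sum vr - sum χq + k
            ≈⟨ +-congʳ (+-congʳ (+-cong sum-bt (sym (directSum-form R v)))) ⟩
          ⟨ 𝐁 *ᵥ v , T *ᵥ y ⟩ + ⟨ v , directSum R *ᵥ v ⟩ - sum χq + k ∎

-- From a single response to a centered random pair.

module Symmetrization (em : ExcludedMiddle 0ℓ) (ℝ : Reals) where
  open Reals ℝ hiding (zero)
  open OrderedField ℝ
  open LinearAlgebra ℝ
  open MatrixProperties ℝ
  open FairCoin em ℝ
  open Probability ℝ

  -- Input and response are to receive the same sign: linear relations such as exactness then
  -- persist, means vanish, and quadratic expressions keep their deterministic values.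
  symmetrize : ∀ {n} → Vector Carrier n → Bool → Vector Carrier n
  symmetrize x ω i = sign ω * x i

  symmetrize-centered : ∀ {n} (x : Vector Carrier n) → Centered coin (symmetrize x)
  symmetrize-centered x i = expectation-odd (x i)

  symmetrize-square : ∀ {n} (x : Vector Carrier n) i →
    Expectation coin (λ ω → symmetrize x ω i * symmetrize x ω i) (x i * x i)
  symmetrize-square x i = expectation-even λ ω → trans
    (solve 2 (λ s x → s :* x :* (s :* x) := s :* (s :* (x :* x))) refl (sign ω) (x i))
    (sign-cancel ω (x i * x i))

  *ᵥ-symmetrize : ∀ {r c} (A : Matrix r c) (x : Vector Carrier c) ω p →
                  (A *ᵥ symmetrize x ω) p ≈ sign ω * (A *ᵥ x) p
  *ᵥ-symmetrize A x ω p = ⟨⟩-*ʳ (sign ω) (A p) x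

  symmetrize-bilinear : ∀ {r c} (A : Matrix r c) (x : Vector Carrier r) (y : Vector Carrier c) ω →
                        ⟨ symmetrize x ω , A *ᵥ symmetrize y ω ⟩ ≈ ⟨ x , A *ᵥ y ⟩
  symmetrize-bilinear A x y ω = begin
    ⟨ symmetrize x ω , A *ᵥ symmetrize y ω ⟩         ≈⟨ ⟨⟩-congˡ (symmetrize x ω) (*ᵥ-symmetrize A y ω) ⟩
    ⟨ symmetrize x ω , (λ p → sign ω * (A *ᵥ y) p) ⟩ ≈⟨ ⟨⟩-*ˡ (sign ω) x _ ⟩
    sign ω * ⟨ x , (λ p → sign ω * (A *ᵥ y) p) ⟩     ≈⟨ *-congˡ (⟨⟩-*ʳ (sign ω) x (A *ᵥ y)) ⟩
    sign ω * (sign ω * ⟨ x , A *ᵥ y ⟩)               ≈⟨ sign-cancel ω _ ⟩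
    ⟨ x , A *ᵥ y ⟩                                   ∎
    where open import Relation.Binary.Reasoning.Setoid setoid

  symmetrize≈0⇒≈0 : ∀ {n} (x : Vector Carrier n) ω →
                    (∀ i → symmetrize x ω i ≈ 0#) → ∀ i → x i ≈ 0#
  symmetrize≈0⇒≈0 x ω sx≈0 i =
    trans (sym (sign-cancel ω (x i))) (trans (*-congˡ (sx≈0 i)) (zeroʳ (sign ω)))

  symmetrize-nonzero : ∀ {m n} (x : Vector Carrier m) (y : Vector Carrier n) →
    ¬ (∀ i → x i ≈ 0#) →
    ¬ AlmostSurely coin (λ ω → (∀ i → symmetrize x ω i ≈ 0#) × (∀ p → symmetrize y ω p ≈ 0#))
  symmetrize-nonzero x y x≉0 as≈0 with almostSurely⇒inhabited as≈0
  ... | ω , sx≈0 , _ = x≉0 (symmetrize≈0⇒≈0 x ω sx≈0)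

lemma3p2 :
  ExcludedMiddle 0ℓ → (ℝ : Reals) →
  let open Reals ℝ
      open LinearAlgebra ℝ
      open Probability ℝ
  in
  (m : ℕ) .{{_ : NonZero m}} →
  (T E : Matrix (m ℕ.* 2) (m ℕ.* 2)) (J N : Matrix (m ℕ.* 2) m)
  (C : Fin m → Carrier) →
  Invertible (I ⊖ T) →
  J ᵀ · J ≋ I →
  (∀ i → 0# < C i) →
  E ⪰ T ᵀ · directSum (λ i → C i ∙ I) · T →
  PairSupported J →
  PairSupported N →
  (W W⁻¹ D : Fin m → Matrix 2 2) (K h : Fin m → Carrier) →
  (∀ i → PosDef (W i)) →
  (∀ i → IsInverse (W i) (W⁻¹ i)) →
  (∀ i → 0# < K i) →
  (∀ i → 0# ≤ h i) →
  let B : Fin m → Matrix 2 2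
      B i = (D i) ᵀ · W⁻¹ i
      U : Fin m → Matrix 2 2
      U i = W⁻¹ i · D i · W i
      R : Fin m → Matrix 2 2
      R i = (4# * C i) ⁻¹ ∙ ((B i) ᵀ · B i)
      d : Fin m → Vector Carrier 2
      d i a = ((B i) ᵀ *ᵥ column J i) a + ((W i) ᵀ *ᵥ column N i) a
      χ : Fin m → Carrier
      χ i = h i + tr (R i)
  in
  (∀ i → tr (block E i · (W i · W i)) + tr (D i · block T i) ≤ h i) →
  (∀ i → 0# < χ i) →
  (∀ i → PosSemidef (Sym (U i) ⊖ (h i ∙ I) ⊖ adj (R i)
                       ⊖ ((4# * K i) ⁻¹ ∙ outer (d i) (d i)))) →
  Σ[ 𝓟 ∈ ProbabilitySpace ]
  let open ProbabilitySpace 𝓟 using (Ω) in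
  Σ[ ξ ∈ (Ω → Vector Carrier m) ]
  Σ[ y ∈ (Ω → Vector Carrier (m ℕ.* 2)) ]
    Centered 𝓟 ξ × Centered 𝓟 y ×
    FiniteSecondMoments 𝓟 ξ × FiniteSecondMoments 𝓟 y ×
    ¬ AlmostSurely 𝓟 (λ ω → (∀ i → ξ ω i ≈ 0#) × (∀ p → y ω p ≈ 0#)) ×
    AlmostSurely 𝓟 (λ ω → ∀ p → ((I ⊖ T) *ᵥ y ω) p ≈ (J *ᵥ ξ ω) p) ×
    (∃[ e ] Σ[ s ∈ Vector Carrier m ]
      Expectation 𝓟 (λ ω → ⟨ y ω , E *ᵥ y ω ⟩ + ⟨ ξ ω , N ᵀ *ᵥ y ω ⟩) e ×
      (∀ i → Expectation 𝓟 (λ ω → ξ ω i * ξ ω i) (s i)) ×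
      e ≤ ∑[ i < m ] (K i * s i))
-- `NonZero m` leaves only a successor, so `G` has a first column to start the deflation from.
lemma3p2 em ℝ (suc k) T E J N C A-inv JᵀJ≋I 0<C E⪰TᵀCT J-supp N-supp
         W W⁻¹ D K h W-posDef W-inverse 0<K 0≤h tr≤h 0<χ slack =
    coin , symmetrize ξ , symmetrize y ,
    symmetrize-centered ξ , symmetrize-centered y ,
    (λ i → _ , symmetrize-square ξ i) , (λ p → _ , symmetrize-square y p) ,
    symmetrize-nonzero ξ y ξ≉0 ,
    surely exact ,
    ⟨ y , E *ᵥ y ⟩ + ⟨ ξ , N ᵀ *ᵥ y ⟩ , (λ i → ξ i * ξ i) ,
    expectation-even (λ ω → +-cong (symmetrize-bilinear E y y ω) (symmetrize-bilinear (N ᵀ) ξ y ω)) ,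
    symmetrize-square ξ ,
    cost-≤ ξ (≤-respʳ-≈ (weight-normSq (G *ᵥ ξ)) form≤)
  where
  open Reals ℝ hiding (zero)
  open OrderedField ℝ
  open LinearAlgebra ℝ
  open Probability ℝ
  open FairCoin em ℝ
  open Symmetrization em ℝ
  open TraceBound em ℝ
  open Response em ℝ
  open Certificate {suc k} T E J N C (proj₁ A-inv) (proj₁ (proj₂ A-inv)) JᵀJ≋I 0<C E⪰TᵀCT J-supp N-supp
    W W⁻¹ D K h W-posDef W-inverse 0<K
  open Bound tr≤h 0<χ slack

  witness : ∃[ ξ ] ¬ (∀ i → ξ i ≈ 0#) ×
              ⟨ G *ᵥ ξ , Φ *ᵥ G *ᵥ ξ ⟩ ≤ ∑[ p < suc k ℕ.* 2 ] (weight p * ((G *ᵥ ξ) p * (G *ᵥ ξ) p))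
  -- The number of columns of `G` is m = k + 1, the same as the bound on the weighted trace of `Φ`.
  witness = form≤normSq weight weight⁻¹
    (λ _ → proj₁ (0<χ _)) (λ _ → ⁻¹-nonNeg (0<χ _))
    (λ _ → trans (*-comm _ _) (*-inverseʳ (<⇒≉0 (0<χ _))))
    k Φ G Φ-positive G-injective weightedTr-Φ

  ξ : Vector Carrier (suc k)
  ξ = proj₁ witness

  ξ≉0 = proj₁ (proj₂ witness)
  form≤ = proj₂ (proj₂ witness)

  y : Vector Carrier (suc k ℕ.* 2)
  y = response ξ

  exact : ∀ ω p → ((I ⊖ T) *ᵥ symmetrize y ω) p ≈ (J *ᵥ symmetrize ξ ω) p
  exact ω p = trans (*ᵥ-symmetrize (I ⊖ T) y ω p)
    (trans (*-congˡ (response-exact ξ p)) (sym (*ᵥ-symmetrize J ξ ω p)))
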